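{- The following decision problem (finite satisfiability of $\mathrm{FO}^2(\leq_1,\leq_2,\precsim_3)$) is undecidable. Input: a two-variable first-order sentence $\varphi$ over a vocabulary consisting of the binary relation symbols $\leq_1$, $\leq_2$, $\precsim_3$ and arbitrarily many unary relation symbols. Question: is there a finite structure with non-empty universe satisfying $\varphi$ in which $\leq_1$ and $\leq_2$ are interpreted as linear orders and $\precsim_3$ as a total preorder?
   Context: Two-variable logic $\mathrm{FO}^2$ is first-order logic (with equality) restricted to formulas using at most the two variables $x$ and $y$ (which may be re-quantified). There is no bound on the number of unary relation symbols, and there are no other non-unary relation symbols than those listed. A total preorder is a transitive binary relation $\precsim$ such that for all $u,v$ one has $u\precsim v$ or $v\precsim u$ (in particular it is reflexive). A linear order is an antisymmetric total preorder. -}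

module Defs where

open import Data.Bool.Base using (Bool; T)
open import Data.Fin.Base using (Fin)
open import Data.Nat.Base using (ℕ; zero; suc; _+_; _<_)
open import Data.Product.Base using (Σ; ∃; ∃-syntax; _×_; proj₁)
open import Data.Sum.Base using (_⊎_)
open import Data.Vec.Base using (Vec; []; _∷_; lookup)
open import Relation.Binary.Core using (Rel)
open import Relation.Binary.PropositionalEquality.Core using (_≡_; _≢_)
open import Relation.Binary.Structures using (IsTotalOrder; IsTotalPreorder)
open import Relation.Nullary.Negation.Core using (¬_)
open import Level using (0ℓ)

------------------------------------------------------------------------
-- Two-variable logic over ≤₁, ≤₂, ≾₃ and unary symbols P₀, P₁, P₂, …

data Var : Set where
  x y : Var

infix  8 _≐_ _≤₁_ _≤₂_ _≾₃_
infixr 7 _∧_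
infixr 6 _∨_

data Formula : Set where
  _≐_ _≤₁_ _≤₂_ _≾₃_ : Var → Var → Formula
  P                  : ℕ → Var → Formula
  ~_                 : Formula → Formula
  _∧_ _∨_            : Formula → Formula → Formula
  all ex             : Var → Formula → Formula

FreeIn : Var → Formula → Set
FreeIn u (v ≐ w)   = u ≡ v ⊎ u ≡ w
FreeIn u (v ≤₁ w)  = u ≡ v ⊎ u ≡ w
FreeIn u (v ≤₂ w)  = u ≡ v ⊎ u ≡ w
FreeIn u (v ≾₃ w)  = u ≡ v ⊎ u ≡ w
FreeIn u (P i v)   = u ≡ v
FreeIn u (~ φ)     = FreeIn u φ
FreeIn u (φ ∧ ψ)   = FreeIn u φ ⊎ FreeIn u ψ
FreeIn u (φ ∨ ψ)   = FreeIn u φ ⊎ FreeIn u ψ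
FreeIn u (all v φ) = u ≢ v × FreeIn u φ
FreeIn u (ex v φ)  = u ≢ v × FreeIn u φ

Sentence : Set
Sentence = Σ Formula λ φ → ∀ v → ¬ FreeIn v φ

Related : {A : Set} → (A → A → Bool) → Rel A 0ℓ
Related r a b = T (r a b)

-- A finite structure with non-empty universe, up to isomorphism.  Relations
-- are Bool-valued, so that satisfaction has its classical meaning.  A sentence
-- mentions only finitely many of the unary symbols interpreted here.
record Structure : Set where
  field
    size-1 : ℕ

  Universe : Set
  Universe = Fin (suc size-1)

  field
    le₁ le₂ le₃      : Universe → Universe → Bool
    pred             : ℕ → Universe → Bool
    isLinearOrder₁   : IsTotalOrder _≡_ (Related le₁)
    isLinearOrder₂   : IsTotalOrder _≡_ (Related le₂)
    isTotalPreorder₃ : IsTotalPreorder _≡_ (Related le₃)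

module _ (M : Structure) where
  open Structure M

  Assignment : Set
  Assignment = Var → Universe

  _[_↦_] : Assignment → Var → Universe → Assignment
  (ρ [ x ↦ a ]) x = a
  (ρ [ x ↦ a ]) y = ρ y
  (ρ [ y ↦ a ]) x = ρ x
  (ρ [ y ↦ a ]) y = a

  Holds : Assignment → Formula → Set
  Holds ρ (v ≐ w)   = ρ v ≡ ρ w
  Holds ρ (v ≤₁ w)  = Related le₁ (ρ v) (ρ w)
  Holds ρ (v ≤₂ w)  = Related le₂ (ρ v) (ρ w)
  Holds ρ (v ≾₃ w)  = Related le₃ (ρ v) (ρ w)
  Holds ρ (P i v)   = T (pred i (ρ v))
  Holds ρ (~ φ)     = ¬ Holds ρ φ
  Holds ρ (φ ∧ ψ)   = Holds ρ φ × Holds ρ ψ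
  Holds ρ (φ ∨ ψ)   = Holds ρ φ ⊎ Holds ρ ψ
  Holds ρ (all v φ) = ∀ a → Holds (ρ [ v ↦ a ]) φ
  Holds ρ (ex v φ)  = ∃[ a ] Holds (ρ [ v ↦ a ]) φ

-- The choice of assignment is immaterial, as sentences have no free variables.
_⊨_ : Structure → Sentence → Set
M ⊨ φ = ∀ ρ → Holds M ρ (proj₁ φ)

FinitelySatisfiable : Sentence → Set
FinitelySatisfiable φ = ∃[ M ] M ⊨ φ

------------------------------------------------------------------------
-- Gödel numbering

triangle : ℕ → ℕ
triangle zero    = zero
triangle (suc n) = suc n + triangle n

-- Cantor's bijection ℕ × ℕ → ℕ.
⟨_,_⟩ : ℕ → ℕ → ℕ
⟨ m , n ⟩ = triangle (m + n) + n

varCode : Var → ℕ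
varCode x = 0
varCode y = 1

-- Injective: the first component of the outer pair is the constructor.
formulaCode : Formula → ℕ
formulaCode (v ≐ w)   = ⟨ 0 , ⟨ varCode v , varCode w ⟩ ⟩
formulaCode (v ≤₁ w)  = ⟨ 1 , ⟨ varCode v , varCode w ⟩ ⟩
formulaCode (v ≤₂ w)  = ⟨ 2 , ⟨ varCode v , varCode w ⟩ ⟩
formulaCode (v ≾₃ w)  = ⟨ 3 , ⟨ varCode v , varCode w ⟩ ⟩
formulaCode (P i v)   = ⟨ 4 , ⟨ i , varCode v ⟩ ⟩
formulaCode (~ φ)     = ⟨ 5 , formulaCode φ ⟩
formulaCode (φ ∧ ψ)   = ⟨ 6 , ⟨ formulaCode φ , formulaCode ψ ⟩ ⟩
formulaCode (φ ∨ ψ)   = ⟨ 7 , ⟨ formulaCode φ , formulaCode ψ ⟩ ⟩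
formulaCode (all v φ) = ⟨ 8 , ⟨ varCode v , formulaCode φ ⟩ ⟩
formulaCode (ex v φ)  = ⟨ 9 , ⟨ varCode v , formulaCode φ ⟩ ⟩

sentenceCode : Sentence → ℕ
sentenceCode φ = formulaCode (proj₁ φ)

------------------------------------------------------------------------
-- Partial recursive functions and undecidability

data PartialRecursive : ℕ → Set where
  zeroᶠ : PartialRecursive 0
  sucᶠ  : PartialRecursive 1
  proj  : ∀ {n} → Fin n → PartialRecursive n
  comp  : ∀ {m n} → PartialRecursive m → Vec (PartialRecursive n) m →
          PartialRecursive n
  rec   : ∀ {n} → PartialRecursive n → PartialRecursive (suc (suc n)) →
          PartialRecursive (suc n)
  min   : ∀ {n} → PartialRecursive (suc n) → PartialRecursive n

infix 4 _[_]⇓_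

-- f [ as ]⇓ b: the value of f at as is defined and equal to b.
data _[_]⇓_ : ∀ {n} → PartialRecursive n → Vec ℕ n → ℕ → Set where
  ⇓zero : zeroᶠ [ [] ]⇓ 0
  ⇓suc  : ∀ {a} → sucᶠ [ a ∷ [] ]⇓ suc a
  ⇓proj : ∀ {n} {as : Vec ℕ n} i → proj i [ as ]⇓ lookup as i
  ⇓comp : ∀ {m n f} {gs : Vec (PartialRecursive n) m} {as bs c} →
          (∀ i → lookup gs i [ as ]⇓ lookup bs i) → f [ bs ]⇓ c →
          comp f gs [ as ]⇓ c
  ⇓rec₀ : ∀ {n} {f : PartialRecursive n} {g as b} →
          f [ as ]⇓ b →
          rec f g [ 0 ∷ as ]⇓ b
  ⇓rec₊ : ∀ {n} {f : PartialRecursive n} {g k as b c} →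
          rec f g [ k ∷ as ]⇓ b → g [ k ∷ b ∷ as ]⇓ c →
          rec f g [ suc k ∷ as ]⇓ c
  ⇓min  : ∀ {n} {f : PartialRecursive (suc n)} {as b} →
          (∀ k → k < b → ∃[ c ] f [ k ∷ as ]⇓ suc c) → f [ b ∷ as ]⇓ 0 →
          min f [ as ]⇓ b

-- Nothing is required of f off the codes of instances, nor is the law of
-- excluded middle for Q presupposed.
Decides : {A : Set} → (A → ℕ) → PartialRecursive 1 → (A → Set) → Set
Decides code f Q =
  ∀ a → (Q a → f [ code a ∷ [] ]⇓ 1) × (¬ Q a → f [ code a ∷ [] ]⇓ 0)

Undecidable : {A : Set} → (A → ℕ) → (A → Set) → Set
Undecidable code Q = ¬ (∃[ f ] Decides code f Q)

{-# OPTIONS --safe #-}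

-- If f decided satisfiability, let g n be f at the code of the sentence formed
-- from the formula with code n and the statement that there are exactly n
-- tokens. It suffices to find a formula θ that has a finite model with exactly
-- n tokens if and only if g n = 0, and to take for n the code of θ.
--
-- So compile g to a counter machine and describe its runs. Events are ordered
-- in time by ≤₁; the tokens precede them and count as increments of register 0.
-- An increment shares its ≾₃-class with the decrement that cancels it. A test
-- for zero lies in ≾₃, as in ≤₁, after the earlier increments and before the
-- later decrements, so the earlier increments have all been cancelled by then.
--
-- Consecutive events are recognised with two variables as follows. On events
-- ≤₁ and ≤₂ agree, and every event has a copy, in its own ≾₃-class, which ≤₁
-- puts before and ≤₂ puts after precisely that event and the next one. The
-- events inverted with a copy form an interval, in which the event itself is
-- determined by the ≾₃-class, and a colouring of events modulo 3 makes the rest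
-- of the interval a single event that comes later.

module Submission where

open import Defs
open import Data.Bool.Base using (Bool; true; false; T; if_then_else_)
open import Data.Bool.Properties using (T?)
open import Data.Empty using (⊥-elim)
open import Data.Fin.Base as Fin using (Fin; toℕ; fromℕ<; combine; splitAt; join)
open import Data.Fin.Patterns using (0F; 1F; 2F)
open import Data.Fin.Properties
  using (_≟_; all?; any?; combine-injective; toℕ-injective; toℕ<n; toℕ-fromℕ<; splitAt-join; join-splitAt)
open import Data.List.Base
  using (List; []; _∷_; _++_; length; foldr; replicate; concatMap; allFin; cartesianProduct)
  renaming (map to mapᴸ; lookup to lookupᴸ)
open import Data.List.Membership.Propositional using (_∈_)
open import Data.List.Membership.Propositional.Properties
  using (∈-++⁺ˡ; ∈-++⁺ʳ; ∈-++⁻; ∈-map⁺; ∈-map⁻; ∈-concatMap⁺; ∈-concatMap⁻; ∈-lookup; ∈-allFin; ∈-cartesianProduct⁺)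
open import Data.List.Properties using (++-assoc; ++-identityʳ)
open import Data.List.Relation.Unary.Any as Any using (here; there)
open import Data.List.Relation.Unary.Any.Properties using (lookup-index)
open import Data.Nat.Base
  using (ℕ; zero; suc; _+_; _*_; _≤_; _<_; _≡ᵇ_; _≤ᵇ_; z≤n; s≤s; s≤s⁻¹)
open import Data.Nat.Properties renaming (_≟_ to _≟ⁿ_; _≤?_ to _≤?ⁿ_)
open import Data.Product.Base using (∃-syntax; _×_; _,_; proj₁; proj₂)
open import Data.Product.Properties using (≡-dec)
open import Data.Sum.Base using (_⊎_; inj₁; inj₂)
open import Data.Unit.Base using (⊤; tt)
open import Data.Vec.Base using (Vec; []; _∷_; lookup; map)
open import Data.Vec.Properties using (lookup-map)
open import Data.Vec.Relation.Unary.All as All using (All; []; _∷_)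
open import Data.Vec.Relation.Unary.All.Properties using (lookup⁺)
open import Function.Base using (_∘_)
open import Relation.Binary.Definitions using (tri<; tri≈; tri>)
open import Relation.Binary.PropositionalEquality
open import Relation.Binary.Structures using (IsTotalOrder; IsTotalPreorder)
open import Relation.Nullary
  using (¬_; Dec; yes; no; does; proof; Reflects; ofʸ; ofⁿ; ¬?; _×-dec_; _⊎-dec_; map′; decidable-stable)
open import Relation.Nullary.Decidable using (isYes; toWitness; fromWitness)

-- Counter programs for partial recursive functions

-- Diagonalising against `f` itself requires neither a universal function nor a prior undecidability
-- result for halting. The self-reference requires no fixed-point theorem: the formula describes `g`
-- without its input, which enters only as the number of tokens, so its code can be taken once it is
-- built. For this, `exactly` must be independent of the machine; it uses only `P 0`, `≤₁` and
-- equality, and its code is computed from the number by pairing with constants.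
--
-- Two variables cannot compare the values of a counter at successive moments. Hence no element
-- stores a value; a counter is the number of increments not yet matched with a decrement.
--
-- A decider is unconstrained off the codes of sentences, so `g` may be partial. The simulation
-- therefore has to be faithful in both directions: a value yields a run, and a terminating run
-- yields a value.

data Stmt : Set where
  incr : ℕ → Stmt
  loop : ℕ → List Stmt → Stmt

Prog : Set
Prog = List Stmt

Reg : Set
Reg = ℕ → ℕ

reflects : ∀ r s → Reflects (r ≡ s) (r ≡ᵇ s)
reflects r s = proof (r ≟ⁿ s)

opaque
  upd : Reg → ℕ → ℕ → Reg
  upd σ r v s = if r ≡ᵇ s then v else σ s

  upd-same : ∀ {σ v} r → upd σ r v r ≡ v
  upd-same r with r ≡ᵇ r | reflects r r
  ... | true  | _        = refl
  ... | false | ofⁿ r≢r = ⊥-elim (r≢r refl)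

  upd-other : ∀ {σ r v s} → r ≢ s → upd σ r v s ≡ σ s
  upd-other {r = r} {s = s} r≢s with r ≡ᵇ s | reflects r s
  ... | true  | ofʸ r≡s = ⊥-elim (r≢s r≡s)
  ... | false | _       = refl

  upd-cong : ∀ {σ τ r v w} → v ≡ w → σ ≗ τ → upd σ r v ≗ upd τ r w
  upd-cong {r = r} v≡w σ≗τ s with r ≡ᵇ s
  ... | true  = v≡w
  ... | false = σ≗τ s

  upd-idem : ∀ {σ r v} → v ≡ σ r → upd σ r v ≗ σ
  upd-idem {r = r} e s with r ≡ᵇ s | reflects r s
  ... | true  | ofʸ refl = e
  ... | false | _        = refl

  upd-upd : ∀ {σ v w} r → upd (upd σ r v) r w ≗ upd σ r w
  upd-upd r s with r ≡ᵇ s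
  ... | true  = refl
  ... | false = refl

  upd-comm : ∀ {σ r s v w} → r ≢ s → upd (upd σ r v) s w ≗ upd (upd σ s w) r v
  upd-comm {r = r} {s} r≢s t with r ≡ᵇ t | s ≡ᵇ t | reflects r t | reflects s t
  ... | true  | true  | ofʸ refl | ofʸ refl = ⊥-elim (r≢s refl)
  ... | true  | false | _ | _ = refl
  ... | false | true  | _ | _ = refl
  ... | false | false | _ | _ = refl

-- loop r q: while r is positive, decrement it and run q.
data Run : Prog → Reg → Reg → Set where
  done : ∀ {σ σ′} → σ ≗ σ′ → Run [] σ σ′
  incr : ∀ {r p σ σ′} → Run p (upd σ r (suc (σ r))) σ′ → Run (incr r ∷ p) σ σ′
  exit : ∀ {r q p σ σ′} → σ r ≡ 0 → Run p σ σ′ → Run (loop r q ∷ p) σ σ′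
  iter : ∀ {r q p σ σ₁ σ′ n} → σ r ≡ suc n → Run q (upd σ r n) σ₁ →
         Run (loop r q ∷ p) σ₁ σ′ → Run (loop r q ∷ p) σ σ′

≗-sym : ∀ {σ τ : Reg} → σ ≗ τ → τ ≗ σ
≗-sym e r = sym (e r)

≗-trans : ∀ {σ τ υ : Reg} → σ ≗ τ → τ ≗ υ → σ ≗ υ
≗-trans e f r = trans (e r) (f r)

-- Registers are functions and are compared only pointwise. `done` absorbs a pointwise equality,
-- which lets whole runs respect it at both ends.
Run-respʳ : ∀ {p σ τ υ} → Run p σ τ → τ ≗ υ → Run p σ υ
Run-respʳ (done e)       f = done (≗-trans e f)
Run-respʳ (incr d)       f = incr (Run-respʳ d f)
Run-respʳ (exit e d)     f = exit e (Run-respʳ d f)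
Run-respʳ (iter e d₁ d₂) f = iter e d₁ (Run-respʳ d₂ f)

Run-respˡ : ∀ {p σ τ υ} → σ ≗ τ → Run p σ υ → Run p τ υ
Run-respˡ f (done e)           = done (≗-trans (≗-sym f) e)
Run-respˡ f (incr {r = r} d)   = incr (Run-respˡ (upd-cong (cong suc (f r)) f) d)
Run-respˡ f (exit e d)         = exit (trans (sym (f _)) e) (Run-respˡ f d)
Run-respˡ f (iter e d₁ d₂)     =
  iter (trans (sym (f _)) e) (Run-respˡ (upd-cong refl f) d₁) d₂

Run-deterministic : ∀ {p σ τ σ′ τ′} → σ ≗ τ → Run p σ σ′ → Run p τ τ′ → σ′ ≗ τ′
Run-deterministic f (done e) (done e′) = ≗-trans (≗-sym e) (≗-trans f e′)
Run-deterministic f (incr {r = r} d) (incr d′) =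
  Run-deterministic (upd-cong (cong suc (f r)) f) d d′
Run-deterministic f (exit e d) (exit e′ d′) = Run-deterministic f d d′
Run-deterministic f (exit {r = r} e d) (iter e′ d₁′ d₂′)
  with () ← trans (sym e) (trans (f r) e′)
Run-deterministic f (iter {r = r} e d₁ d₂) (exit e′ d′)
  with () ← trans (sym e) (trans (f r) e′)
Run-deterministic f (iter {r = r} e d₁ d₂) (iter e′ d₁′ d₂′)
  with refl ← trans (sym e) (trans (f r) e′) =
  Run-deterministic (Run-deterministic (upd-cong refl f) d₁ d₁′) d₂ d₂′

infixr 5 _⨾_

_⨾_ : ∀ {p q σ τ υ} → Run p σ τ → Run q τ υ → Run (p ++ q) σ υ
done e ⨾ d          = Run-respˡ (≗-sym e) d
incr d′ ⨾ d         = incr (d′ ⨾ d)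
exit e d′ ⨾ d       = exit e (d′ ⨾ d)
iter e d₁ d₂ ⨾ d    = iter e d₁ (d₂ ⨾ d)

Run-split : ∀ p {q σ υ} → Run (p ++ q) σ υ → ∃[ τ ] Run p σ τ × Run q τ υ
Run-split [] d = _ , done (λ _ → refl) , d
Run-split (incr r ∷ p) (incr d) with τ , d₁ , d₂ ← Run-split p d = τ , incr d₁ , d₂
Run-split (loop r b ∷ p) (exit e d) with τ , d₁ , d₂ ← Run-split p d =
  τ , exit e d₁ , d₂
Run-split (loop r b ∷ p) (iter e d₀ d) with τ , d₁ , d₂ ← Run-split (loop r b ∷ p) d =
  τ , iter e d₀ d₁ , d₂

-- Clearing, moving and copying registers

clear : ℕ → Prog
clear r = loop r [] ∷ []

move : ℕ → ℕ → Prog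
move s d = loop s (incr d ∷ []) ∷ []

-- A loop destroys the register that it reads, so a second copy is made in the scratch register
-- `suc d` and moved back.
copy : ℕ → ℕ → Prog
copy s d = loop s (incr d ∷ incr (suc d) ∷ []) ∷ move (suc d) s

clear-run : ∀ r {σ} → Run (clear r) σ (upd σ r 0)
clear-run r {σ} = go (σ r) refl
  where
  go : ∀ n {σ} → σ r ≡ n → Run (clear r) σ (upd σ r 0)
  go zero e = exit e (done (≗-sym (upd-idem (sym e))))
  go (suc n) e = iter e (done λ _ → refl) (Run-respʳ (go n (upd-same r)) (upd-upd r))

move-run : ∀ {s d} → s ≢ d → ∀ {σ} →
           Run (move s d) σ (upd (upd σ d (σ s + σ d)) s 0)
move-run {s} {d} s≢d {σ} = go (σ s) refl
  where
  go : ∀ n {σ} → σ s ≡ n → Run (move s d) σ (upd (upd σ d (n + σ d)) s 0)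
  go zero {σ} e = exit e (done (≗-sym (≗-trans (upd-cong refl (upd-idem refl))
                                               (upd-idem (sym e)))))
  go (suc n) {σ} e =
    iter e (incr (done λ _ → refl))
      (Run-respʳ (go n (trans (upd-other (≢-sym s≢d)) (upd-same s))) eq)
    where
    σ₁ = upd σ s n
    σ₂ = upd σ₁ d (suc (σ₁ d))
    v≡ : n + σ₂ d ≡ suc n + σ d
    v≡ = trans (cong (n +_) (trans (upd-same d) (cong suc (upd-other s≢d)))) (+-suc n _)
    eq : upd (upd σ₂ d (n + σ₂ d)) s 0 ≗ upd (upd σ d (suc n + σ d)) s 0
    eq rewrite v≡ = ≗-trans (upd-cong refl (≗-trans (upd-upd d) (upd-comm s≢d))) (upd-upd s)

opaque
  unfolding upd

  -- Compares the outcome of `n` rounds of the copying loop after one round with that of `suc n`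
  -- rounds: at each register only the outermost update counts.
  step-law : ∀ {σ s d n t u v w} →
    upd (upd (upd (upd (upd (upd σ s n) d t) (suc d) u) d v) (suc d) w) s 0 ≗
    upd (upd (upd σ d v) (suc d) w) s 0
  step-law {s = s} {d} r with s ≡ᵇ r | suc d ≡ᵇ r | d ≡ᵇ r
  ... | true  | _     | _     = refl
  ... | false | true  | _     = refl
  ... | false | false | true  = refl
  ... | false | false | false = refl

  end-law : ∀ {σ s t d u v} → s ≢ d → t ≢ d → σ t ≡ 0 →
    upd (upd (upd (upd (upd σ d v) t u) s 0) s (σ s)) t 0 ≗ upd σ d v
  end-law {s = s} {t} {d} s≢d t≢d t≡0 r
    with t ≡ᵇ r | s ≡ᵇ r | d ≡ᵇ r | reflects t r | reflects s r | reflects d r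
  ... | true  | _     | true  | ofʸ refl | _ | ofʸ refl = ⊥-elim (t≢d refl)
  ... | true  | _     | false | ofʸ refl | _ | _ = sym t≡0
  ... | false | true  | true  | _ | ofʸ refl | ofʸ refl = ⊥-elim (s≢d refl)
  ... | false | true  | false | _ | ofʸ refl | _ = refl
  ... | false | false | true  | _ | _ | _ = refl
  ... | false | false | false | _ | _ | _ = refl

copy-run : ∀ {s d σ} → s < d → σ (suc d) ≡ 0 → Run (copy s d) σ (upd σ d (σ s + σ d))
copy-run {s} {d} {σ} s<d t≡0 =
  Run-respʳ (go (σ s) refl ⨾ move-run t≢s) eq
  where
  s≢d : s ≢ d
  s≢d = <⇒≢ s<d
  t≢s : suc d ≢ s
  t≢s e = <⇒≢ (m<n⇒m<1+n s<d) (sym e)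
  t≢d : suc d ≢ d
  t≢d = 1+n≢n
  after : Reg → ℕ → Reg
  after σ n = upd (upd (upd σ d (n + σ d)) (suc d) (n + σ (suc d))) s 0
  go : ∀ n {σ} → σ s ≡ n →
       Run (loop s (incr d ∷ incr (suc d) ∷ []) ∷ []) σ (after σ n)
  go zero {σ} e = exit e (done (≗-sym
    (≗-trans (upd-cong refl (≗-trans (upd-cong refl (upd-idem refl)) (upd-idem refl)))
             (upd-idem (sym e)))))
  go (suc n) {σ} e =
    iter e (incr (incr (done λ _ → refl)))
      (Run-respʳ (go n (trans (upd-other t≢s) (trans (upd-other (≢-sym s≢d)) (upd-same s)))) eq′)
    where
    σ₁ = upd σ s n
    σ₂ = upd σ₁ d (suc (σ₁ d))
    σ₃ = upd σ₂ (suc d) (suc (σ₂ (suc d)))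
    d≡ : n + σ₃ d ≡ suc n + σ d
    d≡ = trans (cong (n +_) (trans (upd-other t≢d) (trans (upd-same d)
           (cong suc (upd-other s≢d))))) (+-suc n _)
    t≡ : n + σ₃ (suc d) ≡ suc n + σ (suc d)
    t≡ = trans (cong (n +_) (trans (upd-same (suc d))
           (cong suc (trans (upd-other (≢-sym t≢d)) (upd-other (≢-sym t≢s)))))) (+-suc n _)
    eq′ : after σ₃ n ≗ after σ (suc n)
    eq′ rewrite d≡ | t≡ = step-law
  τ = after σ (σ s)
  v≡ : τ (suc d) + τ s ≡ σ s
  v≡ = trans (cong₂ _+_ (trans (upd-other (≢-sym t≢s)) (trans (upd-same (suc d))
                          (trans (cong (σ s +_) t≡0) (+-identityʳ _))))
                        (upd-same s))
             (+-identityʳ _)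
  eq : upd (upd τ s (τ (suc d) + τ s)) (suc d) 0 ≗ upd σ d (σ s + σ d)
  eq rewrite v≡ = end-law s≢d t≢d t≡0

-- Compilation into counter programs

Clean : Reg → ℕ → Set
Clean σ o = ∀ r → o ≤ r → σ r ≡ 0

range : ℕ → (m : ℕ) → Vec ℕ m
range k zero    = []
range k (suc m) = k ∷ range (suc k) m

fill : ∀ {m} → Reg → ℕ → Vec ℕ m → Reg
fill σ k []       = σ
fill σ k (b ∷ bs) = fill (upd σ k b) (suc k) bs

fill-below : ∀ {m σ k r} (bs : Vec ℕ m) → r < k → fill σ k bs r ≡ σ r
fill-below []       r<k = refl
fill-below (b ∷ bs) r<k =
  trans (fill-below bs (m<n⇒m<1+n r<k)) (upd-other (≢-sym (<⇒≢ r<k)))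

fill-clean : ∀ {m σ k} (bs : Vec ℕ m) → Clean σ k → Clean (fill σ k bs) (m + k)
fill-clean [] c r le = c r le
fill-clean {suc m} {k = k} (b ∷ bs) c r le = fill-clean bs c′ r (subst (_≤ r) (sym (+-suc m k)) le)
  where
  c′ : Clean (upd _ k b) (suc k)
  c′ r le = trans (upd-other (<⇒≢ le)) (c r (<⇒≤ le))

map-range : ∀ {m σ k} (bs : Vec ℕ m) → map (fill σ k bs) (range k m) ≡ bs
map-range [] = refl
map-range {k = k} (b ∷ bs) = cong₂ _∷_ (trans (fill-below bs ≤-refl) (upd-same k)) (map-range bs)

range-bounded : ∀ k m → All (_< m + k) (range k m)
range-bounded k zero    = []
range-bounded k (suc m) =
  s≤s (m≤n+m k m) ∷ subst (λ b → All (_< b) (range (suc k) m)) (+-suc m k) (range-bounded (suc k) m)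

wipe : Reg → ℕ → ℕ → Reg
wipe σ k zero    = σ
wipe σ k (suc m) = wipe (upd σ k 0) (suc k) m

clearAll : ℕ → ℕ → Prog
clearAll k zero    = []
clearAll k (suc m) = clear k ++ clearAll (suc k) m

clearAll-run : ∀ k m {σ} → Run (clearAll k m) σ (wipe σ k m)
clearAll-run k zero    = done (λ _ → refl)
clearAll-run k (suc m) = clear-run k ⨾ clearAll-run (suc k) m

wipe-below : ∀ {σ k} m {r} → r < k → wipe σ k m r ≡ σ r
wipe-below zero    r<k = refl
wipe-below (suc m) r<k =
  trans (wipe-below m (m<n⇒m<1+n r<k)) (upd-other (≢-sym (<⇒≢ r<k)))

wipe-clean : ∀ {σ k} m → Clean σ (m + k) → Clean (wipe σ k m) k
wipe-clean zero c = c
wipe-clean {σ} {k} (suc m) c r le with m≤n⇒m<n∨m≡n le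
... | inj₂ refl = trans (wipe-below m ≤-refl) (upd-same k)
... | inj₁ k<r  = wipe-clean m c′ r k<r
  where
  c′ : Clean (upd σ k 0) (m + suc k)
  c′ r le′ rewrite +-suc m k = trans (upd-other (<⇒≢ (≤-trans (s≤s (m≤n+m k m)) le′))) (c r le′)

map-agree : ∀ {n o} {σ τ : Reg} {as : Vec ℕ n} → All (_< o) as → (∀ {r} → r < o → τ r ≡ σ r) →
            map τ as ≡ map σ as
map-agree []         f = refl
map-agree (lt ∷ lts) f = cong₂ _∷_ (f lt) (map-agree lts f)

weaken : ∀ {n o o′} {as : Vec ℕ n} → o ≤ o′ → All (_< o) as → All (_< o′) as
weaken le = All.map (λ lt → ≤-trans lt le)

-- compile f as o stores in register o the value of f at the contents of the
-- registers as, using only registers from o on, all of them initially zero.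
compile    : ∀ {n} → PartialRecursive n → Vec ℕ n → ℕ → Prog
compileAll : ∀ {m n} → Vec (PartialRecursive n) m → Vec ℕ n → ℕ → Prog

recBody : ∀ {n} → PartialRecursive (suc (suc n)) → Vec ℕ n → ℕ → Prog
minBody : ∀ {n} → PartialRecursive (suc n) → Vec ℕ n → ℕ → Prog

compile zeroᶠ        as       o = []
compile sucᶠ         (a ∷ []) o = copy a o ++ incr o ∷ []
compile (proj i)     as       o = copy (lookup as i) o
compile (comp {m} f gs) as    o =
  compileAll gs as (suc o) ++ compile f (range (suc o) m) (m + suc o) ++
  move (m + suc o) o ++ clearAll (suc o) m
compile (rec f g) (a ∷ as)    o =
  copy a (1 + o) ++ compile f as (2 + o) ++ (loop (1 + o) (recBody g as o) ∷ []) ++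
  move (2 + o) o ++ clear (3 + o)
compile (min f)      as       o =
  compile f (o ∷ as) (1 + o) ++ loop (1 + o) (minBody f as o) ∷ []

recBody g as o =
  compile g (3 + o ∷ 2 + o ∷ as) (4 + o) ++ clear (2 + o) ++ move (4 + o) (2 + o) ++
  incr (3 + o) ∷ []

minBody f as o = clear (1 + o) ++ incr o ∷ compile f (o ∷ as) (1 + o)

compileAll []       as o = []
compileAll (g ∷ gs) as o = compile g as o ++ compileAll gs as (suc o)

record Ready {n} (as : Vec ℕ n) (o : ℕ) (σ : Reg) : Set where
  constructor ready
  field
    bounded : All (_< o) as
    clean   : Clean σ o

open Ready

upd-below : ∀ {σ o v r} → r < o → upd σ o v r ≡ σ r
upd-below lt = upd-other (≢-sym (<⇒≢ lt))

upd-clean : ∀ {σ o v} → Clean σ o → Clean (upd σ o v) (suc o)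
upd-clean c r le = trans (upd-other (<⇒≢ le)) (c r (<⇒≤ le))

next-ready : ∀ {n} {as : Vec ℕ n} {o σ v} → Ready as o σ → Ready as (suc o) (upd σ o v)
next-ready (ready b c) = ready (weaken (n≤1+n _) b) (upd-clean c)

next-map : ∀ {n} {as : Vec ℕ n} {o σ v} → Ready as o σ → map (upd σ o v) as ≡ map σ as
next-map (ready b c) = map-agree b upd-below

-- The registers of the loop of rec f g: the number of rounds left, the current
-- value and the number of rounds done.
recState : Reg → ℕ → ℕ → ℕ → ℕ → Reg
recState σ o c b i = upd (upd (upd σ (1 + o) c) (2 + o) b) (3 + o) i

minState : Reg → ℕ → ℕ → ℕ → Reg
minState σ o i v = upd (upd σ o i) (1 + o) v

off : ∀ j {k} → suc (j + k) ≢ k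
off j {k} e = m≢1+n+m k {j} (sym e)

opaque
  unfolding upd

  -- The end of `rec`: the value has been moved to `o` and the other three registers of the loop are
  -- zero again, as they were in `σ`.
  rec-law : ∀ {σ o b i} → Clean σ (suc o) →
    upd (upd (upd (recState σ o 0 b i) o b) (2 + o) 0) (3 + o) 0 ≗ upd σ o b
  rec-law {o = o} c r
    with 3 + o ≡ᵇ r | 2 + o ≡ᵇ r | o ≡ᵇ r | 1 + o ≡ᵇ r
       | reflects (3 + o) r | reflects (2 + o) r | reflects o r | reflects (1 + o) r
  ... | true  | _     | true  | _     | ofʸ refl | _ | ofʸ e | _ = ⊥-elim (off 2 (sym e))
  ... | true  | _     | false | _     | ofʸ refl | _ | _ | _ = sym (c _ (s≤s (m≤n+m o 2)))
  ... | false | true  | true  | _     | _ | ofʸ refl | ofʸ e | _ = ⊥-elim (off 1 (sym e))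
  ... | false | true  | false | _     | _ | ofʸ refl | _ | _ = sym (c _ (s≤s (m≤n+m o 1)))
  ... | false | false | true  | _     | _ | _ | _ | _ = refl
  ... | false | false | false | true  | _ | _ | _ | ofʸ refl = sym (c _ ≤-refl)
  ... | false | false | false | false | _ | _ | _ | _ = refl

  body-law : ∀ {σ o b b′ c i} → σ (4 + o) ≡ 0 →
    upd (upd (upd (upd (upd (recState σ o c b i) (4 + o) b′) (2 + o) 0) (2 + o) b′) (4 + o) 0)
        (3 + o) (suc i) ≗
    recState σ o c b′ (suc i)
  body-law {o = o} z r
    with 3 + o ≡ᵇ r | 4 + o ≡ᵇ r | 2 + o ≡ᵇ r | 1 + o ≡ᵇ r
       | reflects (4 + o) r | reflects (2 + o) r | reflects (1 + o) r
  ... | true  | _     | _     | _     | _ | _ | _ = refl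
  ... | false | true  | true  | _     | ofʸ refl | ofʸ e | _ = ⊥-elim (off 1 (sym e))
  ... | false | true  | false | true  | ofʸ refl | _ | ofʸ e = ⊥-elim (off 2 (sym e))
  ... | false | true  | false | false | ofʸ refl | _ | _ = sym z
  ... | false | false | true  | _     | _ | _ | _ = refl
  ... | false | false | false | _     | _ | _ | _ = refl

  round-law : ∀ {σ o c c′ b i} → recState σ o c b i ≗ upd (recState σ o c′ b i) (1 + o) c
  round-law {o = o} r
    with 3 + o ≡ᵇ r | 2 + o ≡ᵇ r | 1 + o ≡ᵇ r
       | reflects (3 + o) r | reflects (2 + o) r | reflects (1 + o) r
  ... | true  | _     | true  | ofʸ refl | _ | ofʸ e = ⊥-elim (off 1 (sym e))
  ... | true  | _     | false | _ | _ | _ = refl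
  ... | false | true  | true  | _ | ofʸ refl | ofʸ e = ⊥-elim (off 0 (sym e))
  ... | false | true  | false | _ | _ | _ = refl
  ... | false | false | true  | _ | _ | _ = refl
  ... | false | false | false | _ | _ | _ = refl

recState-left : ∀ σ o c b i → recState σ o c b i (1 + o) ≡ c
recState-left σ o c b i = trans (upd-other (off 1)) (trans (upd-other (off 0)) (upd-same _))

-- Stated for any `υ` that the clearing can reach, so that it serves both to construct a run and to
-- analyse a given one.
minRound-law : ∀ {σ o i v τ υ} → τ ≗ minState σ o i (suc v) →
               Run (clear (1 + o)) (upd τ (1 + o) v) υ → upd υ o (suc (υ o)) ≗ minState σ o (suc i) 0
minRound-law {σ} {o} {i} {υ = υ} e r =
  ≗-trans (upd-cong (cong suc (trans (υ≗ o) (trans (upd-other (off 0)) (upd-same o)))) υ≗)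
    (≗-trans (upd-comm (off 0)) (upd-cong refl (upd-upd o)))
  where
  υ≗ : υ ≗ minState σ o i 0
  υ≗ = ≗-trans (Run-deterministic (upd-cong refl e) r (clear-run (1 + o)))
         (≗-trans (upd-upd _) (upd-upd _))

widen : ∀ {n} {as : Vec ℕ n} {o σ} → Ready as o σ → Ready as (suc o) σ
widen R = ready (weaken (n≤1+n _) (bounded R)) (λ r le → clean R r (<⇒≤ le))

module _ {n : ℕ} {as : Vec ℕ n} {o : ℕ} {σ : Reg} (R : Ready as o σ) where

  rec-ready : ∀ {c b i} → Ready (3 + o ∷ 2 + o ∷ as) (4 + o) (recState σ o c b i)
  rec-ready = ready (≤-refl ∷ n≤1+n _ ∷ bounded S) (clean S)
    where S = next-ready (next-ready (next-ready (widen R)))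

  rec-map : ∀ {c b i} → map (recState σ o c b i) (3 + o ∷ 2 + o ∷ as) ≡ i ∷ b ∷ map σ as
  rec-map = cong₂ _∷_ (upd-same _) (cong₂ _∷_ (trans (upd-other (λ e → 1+n≢n e)) (upd-same _))
    (trans (next-map (next-ready (next-ready (widen R))))
      (trans (next-map (next-ready (widen R))) (next-map (widen R)))))

  min-ready : ∀ {i} → Ready (o ∷ as) (1 + o) (minState σ o i 0)
  min-ready = ready (≤-refl ∷ bounded (next-ready {v = 0} R)) c
    where
    c : Clean (minState σ o _ 0) (1 + o)
    c r le with m≤n⇒m<n∨m≡n le
    ... | inj₂ refl = upd-same _
    ... | inj₁ lt   = clean (next-ready (next-ready R)) r lt

  min-map : ∀ {i} → map (minState σ o i 0) (o ∷ as) ≡ i ∷ map σ as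
  min-map = cong₂ _∷_ (trans (upd-below ≤-refl) (upd-same _))
                      (trans (next-map (next-ready R)) (next-map R))

-- Values yield runs

compile-run    : ∀ {n} (f : PartialRecursive n) {as o σ vs b} → Ready as o σ →
                 map σ as ≡ vs → f [ vs ]⇓ b → Run (compile f as o) σ (upd σ o b)
compileAll-run : ∀ {m n} (gs : Vec (PartialRecursive n) m) {as o σ bs} → Ready as o σ →
                 (∀ i → lookup gs i [ map σ as ]⇓ lookup bs i) →
                 Run (compileAll gs as o) σ (fill σ o bs)
-- A derivation for `rec` has its last round outermost, whereas the loop executes that round last.
-- The statement therefore takes the run of the `c` rounds still to come as a continuation and puts
-- the `k` earlier rounds in front of it.
rec-run        : ∀ {n} (f : PartialRecursive n) g {as o σ k b} → Ready as o σ →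
                 rec f g [ k ∷ map σ as ]⇓ b →
                 ∃[ b₀ ] f [ map σ as ]⇓ b₀ × (∀ c {τ} →
                 Run (loop (1 + o) (recBody g as o) ∷ []) (recState σ o c b k) τ →
                 Run (loop (1 + o) (recBody g as o) ∷ []) (recState σ o (k + c) b₀ 0) τ)
recBody-run    : ∀ {n} (g : PartialRecursive (suc (suc n))) {as o σ c b i b′} → Ready as o σ →
                 g [ i ∷ b ∷ map σ as ]⇓ b′ →
                 Run (recBody g as o) (recState σ o c b i) (recState σ o c b′ (suc i))
-- Induction on `j`, the number of candidates between the current `i` and the result.
min-run        : ∀ {n} (f : PartialRecursive (suc n)) {as o σ b} → Ready as o σ →
                 (∀ k → k < b → ∃[ c ] f [ k ∷ map σ as ]⇓ suc c) →
                 f [ b ∷ map σ as ]⇓ 0 → ∀ j i → j + i ≡ b →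
                 Run (compile f (o ∷ as) (1 + o) ++ loop (1 + o) (minBody f as o) ∷ [])
                     (minState σ o i 0) (minState σ o b 0)

copy-out : ∀ {a o σ b} → a < o → Clean σ o → σ a ≡ b → Run (copy a o) σ (upd σ o b)
copy-out {a} {o} {σ} a<o c refl = subst (λ v → Run (copy a o) σ (upd σ o v))
  (trans (cong (σ a +_) (c o ≤-refl)) (+-identityʳ _)) (copy-run a<o (c (suc o) (n≤1+n o)))

compile-run zeroᶠ R e ⇓zero = done (λ r → sym (upd-idem (sym (clean R _ ≤-refl)) r))
compile-run sucᶠ {as = a ∷ []} (ready (a<o ∷ []) c) refl ⇓suc =
  copy-out a<o c refl ⨾ incr (done (≗-trans (upd-cong (cong suc (upd-same _)) λ _ → refl) (upd-upd _)))
compile-run (proj i) {as} {σ = σ} R refl (⇓proj i) =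
  copy-out (lookup⁺ (bounded R) i) (clean R) (sym (lookup-map i σ as))
compile-run (comp {m} f gs) {as} {o} {σ} {b = c} R refl (⇓comp {bs = bs} ds d) =
  compileAll-run gs {bs = bs} (ready (weaken (n≤1+n _) (bounded R)) (λ r le → clean R r (<⇒≤ le))) ds ⨾
  compile-run f (ready (range-bounded (suc o) m) c₁)
    (map-range bs) d ⨾
  move-run s≢o ⨾ Run-respʳ (clearAll-run (suc o) m) eq
  where
  s = m + suc o
  τ = fill σ (suc o) bs
  υ = upd τ s c
  π = upd (upd υ o (υ s + υ o)) s 0
  o<s : o < s
  o<s = m≤n+m (suc o) m
  s≢o : s ≢ o
  s≢o e = <⇒≢ o<s (sym e)
  c₁ : Clean τ s
  c₁ = fill-clean bs (λ r le → clean R r (<⇒≤ le))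
  eq : wipe π (suc o) m ≗ upd σ o c
  eq r with <-cmp r o
  ... | tri< r<o _ _ = trans (wipe-below m (m<n⇒m<1+n r<o)) (trans
          (upd-other (λ e → <⇒≢ (<-trans r<o o<s) (sym e))) (trans
          (upd-below r<o) (trans (upd-other (λ e → <⇒≢ (<-trans r<o o<s) (sym e))) (trans
          (fill-below bs (m<n⇒m<1+n r<o)) (sym (upd-below r<o))))))
  ... | tri≈ _ refl _ = trans (wipe-below m ≤-refl) (trans (upd-other s≢o) (trans (upd-same o) (trans
          (cong₂ _+_ (upd-same s) (trans (upd-other s≢o) (trans (fill-below bs ≤-refl) (clean R o ≤-refl))))
          (trans (+-identityʳ c) (sym (upd-same o))))))
  ... | tri> _ _ o<r = trans (wipe-clean m c₂ r o<r)
          (sym (trans (upd-other (<⇒≢ o<r)) (clean R r (<⇒≤ o<r))))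
    where
    c₂ : Clean π s
    c₂ q le with m≤n⇒m<n∨m≡n le
    ... | inj₂ refl = upd-same s
    ... | inj₁ s<q  = trans (upd-other (<⇒≢ s<q)) (trans (upd-other (<⇒≢ (<-trans o<s s<q)))
                        (trans (upd-other (<⇒≢ s<q)) (c₁ q le)))
compile-run (rec f g) {a ∷ as} {o} {σ} {b = b} (ready (a<o ∷ bd) c) refl d
  with b₀ , d₀ , loops ← rec-run f g (ready bd c) d =
  copy-out (m<n⇒m<1+n a<o) (λ r le → c r (<⇒≤ le)) refl ⨾
  compile-run f (next-ready (widen (ready bd c))) (next-map (widen (ready bd c))) d₀ ⨾
  -- After `σ a` rounds none is left, so the continuation is an immediate exit.
  Run-respˡ st (loops 0 (exit (trans (upd-other (off 1)) (trans (upd-other (off 0)) (upd-same _))) (done λ _ → refl))) ⨾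
  move-run (off 1) ⨾ Run-respʳ (clear-run (3 + o)) eq
  where
  st : recState σ o (σ a + 0) b₀ 0 ≗ upd (upd σ (1 + o) (σ a)) (2 + o) b₀
  st = ≗-trans (upd-cong refl (upd-cong refl (upd-cong (+-identityʳ _) λ _ → refl)))
    (upd-idem (sym (trans (upd-other (≢-sym (off 0))) (trans (upd-other (≢-sym (off 1)))
      (c _ (m≤n+m o 3))))))
  τ = recState σ o 0 b (σ a)
  eq : upd (upd (upd τ o (τ (2 + o) + τ o)) (2 + o) 0) (3 + o) 0 ≗ upd σ o b
  v≡ : τ (2 + o) + τ o ≡ b
  v≡ = trans (cong₂ _+_ (trans (upd-other (off 0)) (upd-same _))
               (trans (upd-other (off 2)) (trans (upd-other (off 1)) (trans (upd-other (off 0)) (c o ≤-refl)))))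
             (+-identityʳ b)
  eq rewrite v≡ = rec-law (λ r le → c r (<⇒≤ le))
compile-run (min f) {as} {o} {σ} {b = b} R refl (⇓min pos d) =
  Run-respˡ (≗-trans (upd-idem (sym (clean (next-ready R) _ ≤-refl))) (upd-idem (sym (clean R o ≤-refl))))
    (Run-respʳ (min-run f R pos d b 0 (+-identityʳ b)) (upd-idem (sym (clean (next-ready R) _ ≤-refl))))

compileAll-run []       {bs = []}     R ds = done (λ _ → refl)
compileAll-run (g ∷ gs) {bs = b ∷ bs} R ds =
  compile-run g R refl (ds 0F) ⨾
  compileAll-run gs {bs = bs} (next-ready R)
    (λ i → subst (λ vs → lookup gs i [ vs ]⇓ lookup bs i) (sym (next-map R)) (ds (Fin.suc i)))

rec-run f g R (⇓rec₀ d) = _ , d , λ c r → r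
rec-run f g {as} {o} {σ} {suc k} R (⇓rec₊ {b = b} d e)
  with b₀ , d₀ , loops ← rec-run f g R d =
  b₀ , d₀ , λ c {τ} r → subst (λ n → Run (loop (1 + o) (recBody g as o) ∷ []) (recState σ o n b₀ 0) τ) (+-suc k c)
    (loops (suc c) (iter (trans (upd-other (off 1)) (trans (upd-other (off 0)) (upd-same _)))
      (Run-respˡ round-law (recBody-run g R e)) r))

recBody-run g {as} {o} {σ} {c} {b} {i} {b′} R e =
  compile-run g (rec-ready R) (rec-map R) e ⨾
  clear-run (2 + o) ⨾ move-run (off 1) ⨾ incr (done eq)
  where
  S = recState σ o c b i
  X = upd (upd S (4 + o) b′) (2 + o) 0
  w = X (4 + o) + X (2 + o)
  Y = upd (upd X (2 + o) w) (4 + o) 0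
  w≡ : w ≡ b′
  w≡ = trans (cong₂ _+_ (trans (upd-other (≢-sym (off 1))) (upd-same _)) (upd-same _)) (+-identityʳ b′)
  i≡ : Y (3 + o) ≡ i
  i≡ = trans (upd-other (off 0)) (trans (upd-other (≢-sym (off 0))) (trans (upd-other (≢-sym (off 0)))
         (trans (upd-other (off 0)) (upd-same _))))
  eq : upd Y (3 + o) (suc (Y (3 + o))) ≗ recState σ o c b′ (suc i)
  eq rewrite i≡ | w≡ = body-law (clean R _ (m≤n+m o 4))

min-run f {as} {o} {σ} {b} R pos d zero i refl =
  compile-run f (min-ready R) (min-map R) d ⨾
  exit (upd-same _) (done (upd-upd _))
min-run f {as} {o} {σ} {b} R pos d (suc j) i e
  with v , dᵢ ← pos i (subst (i <_) e (s≤s (m≤n+m i j)))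
  -- The computation of `f` at candidate `suc i` is the end of the loop body at `i`; the run from
  -- `suc i` is cut after it and reassembled.
  with τ , r₁ , r₂ ← Run-split (compile f (o ∷ as) (1 + o)) (min-run f R pos d j (suc i) (trans (+-suc j i) e)) =
  compile-run f (min-ready R) (min-map R) dᵢ ⨾
  iter (upd-same _) (clear-run (1 + o) ⨾ incr (Run-respˡ (≗-sym (minRound-law (upd-upd _) (clear-run (1 + o)))) r₁)) r₂

-- Runs yield values

compile-result : ∀ {n} (f : PartialRecursive n) {as o σ σ′ vs b} → Ready as o σ →
                 map σ as ≡ vs → f [ vs ]⇓ b → Run (compile f as o) σ σ′ → σ′ ≗ upd σ o b
compile-result f R e d r = Run-deterministic (λ _ → refl) r (compile-run f R e d)

-- Recursion on `f`. Once a subprogram is known to compute a value, determinism identifies the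
-- registers that it leaves with the prescribed ones, and the next subprogram can be treated.
run-defined    : ∀ {n} (f : PartialRecursive n) {as o σ σ′ vs} → Ready as o σ →
                 map σ as ≡ vs → Run (compile f as o) σ σ′ → ∃[ b ] f [ vs ]⇓ b
runAll-defined : ∀ {m n} (gs : Vec (PartialRecursive n) m) {as o σ σ′} → Ready as o σ →
                 Run (compileAll gs as o) σ σ′ →
                 ∃[ bs ] ∀ i → lookup gs i [ map σ as ]⇓ lookup bs i
-- Each round extends the derivation by one `⇓rec₊`. The recursion is on the number `c` of rounds
-- left, since the loop cannot exit before it is zero.
rec-defined    : ∀ {n} (f : PartialRecursive n) g {as o σ σ′ τ} c {b i} → Ready as o σ →
                 rec f g [ i ∷ map σ as ]⇓ b → τ ≗ recState σ o c b i →
                 Run (loop (1 + o) (recBody g as o) ∷ []) τ σ′ →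
                 ∃[ b′ ] rec f g [ c + i ∷ map σ as ]⇓ b′
-- Recursion on the run of the loop: an exit shows the current value to be zero, and an iteration
-- shows it to be positive, which is the next premise of `⇓min`.
min-defined    : ∀ {n} (f : PartialRecursive (suc n)) {as o σ σ′ τ i v} → Ready as o σ →
                 (∀ k → k < i → ∃[ c ] f [ k ∷ map σ as ]⇓ suc c) →
                 f [ i ∷ map σ as ]⇓ v → τ ≗ minState σ o i v →
                 Run (loop (1 + o) (minBody f as o) ∷ []) τ σ′ →
                 ∃[ b ] min f [ map σ as ]⇓ b

run-defined zeroᶠ {[]} R refl r = _ , ⇓zero
run-defined sucᶠ {a ∷ []} R refl r = _ , ⇓suc
run-defined (proj i) R refl r = _ , ⇓proj i
run-defined (comp {m} f gs) {as} {o} {σ} R refl r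
  with τ , r₁ , r′ ← Run-split (compileAll gs as (suc o)) r
  with bs , ds ← runAll-defined gs (widen R) r₁
  with υ , r₂ , _ ← Run-split (compile f (range (suc o) m) (m + suc o)) r′
  with c , d ← run-defined f (ready (range-bounded (suc o) m) (fill-clean bs (clean (widen R))))
                 (map-range bs)
                 (Run-respˡ (Run-deterministic (λ _ → refl) r₁
                   (compileAll-run gs {bs = bs} (widen R) ds)) r₂)
  = c , ⇓comp ds d
run-defined (rec f g) {a ∷ as} {o} {σ} (ready (a<o ∷ bd) c) refl r
  with R ← ready bd c
  with τ , r₁ , r′ ← Run-split (copy a (1 + o)) r
  with υ , r₂ , r″ ← Run-split (compile f as (2 + o)) r′
  with _ , r₃ , _ ← Run-split (loop (1 + o) (recBody g as o) ∷ []) r″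
  with r₂′ ← Run-respˡ (Run-deterministic (λ _ → refl) r₁
               (copy-out (m<n⇒m<1+n a<o) (clean (widen R)) refl)) r₂
  with b₀ , d₀ ← run-defined f (next-ready (widen R)) (next-map (widen R)) r₂′
  with b , d ← rec-defined f g (σ a) R (⇓rec₀ d₀)
                 (≗-trans (compile-result f (next-ready (widen R)) (next-map (widen R)) d₀ r₂′)
                   (≗-sym (upd-idem (sym (clean (next-ready (next-ready (widen R))) _ ≤-refl))))) r₃
  = b , subst (λ k → rec f g [ k ∷ map σ as ]⇓ b) (+-identityʳ (σ a)) d
run-defined (min f) {as} {o} {σ} R refl r
  with τ , r₁ , r₂ ← Run-split (compile f (o ∷ as) (1 + o)) r
  with r₁′ ← Run-respˡ (≗-sym (≗-trans (upd-idem (sym (clean (next-ready {v = 0} R) _ ≤-refl)))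
                                       (upd-idem (sym (clean R o ≤-refl))))) r₁
  with v , d ← run-defined f (min-ready R) (min-map R) r₁′
  = min-defined f R (λ _ ()) d
      (≗-trans (compile-result f (min-ready R) (min-map R) d r₁′) (upd-upd _)) r₂

runAll-defined []       R r = [] , λ ()
runAll-defined (g ∷ gs) {as} {o} R r
  with τ , r₁ , r₂ ← Run-split (compile g as o) r
  with b , d ← run-defined g R refl r₁
  with bs , ds ← runAll-defined gs (next-ready R) (Run-respˡ (compile-result g R refl d r₁) r₂)
  = b ∷ bs , λ { 0F → d
               ; (Fin.suc i) → subst (λ vs → lookup gs i [ vs ]⇓ lookup bs i) (next-map R) (ds i) }

rec-defined f g zero R d e r = _ , d
rec-defined f g {as} {o} {σ} {τ = τ} (suc c) {b} {i} R d e (exit z r)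
  with () ← trans (sym z) (trans (e _) (recState-left σ o (suc c) b i))
rec-defined f g {as} {o} {σ} {τ = τ} (suc c) {b} {i} R d e (iter {σ₁ = σ₁} z r₁ r₂)
  with refl ← trans (sym z) (trans (e _) (recState-left σ o (suc c) b i))
  with r₁′ ← Run-respˡ (≗-trans (upd-cong refl e) (≗-sym round-law)) r₁
  with _ , r₃ , _ ← Run-split (compile g (3 + o ∷ 2 + o ∷ as) (4 + o)) r₁′
  with b′ , d′ ← run-defined g (rec-ready R) (rec-map R) r₃
  with b″ , d″ ← rec-defined f g c R (⇓rec₊ d d′)
                   (Run-deterministic (λ _ → refl) r₁′ (recBody-run g R d′)) r₂
  = b″ , subst (λ k → rec f g [ k ∷ map σ as ]⇓ b″) (+-suc c i) d″

min-defined f {as} {σ = σ} {i = i} R pos d e (exit z r) =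
  i , ⇓min pos (subst (λ v → f [ i ∷ map σ as ]⇓ v) (trans (sym (trans (e _) (upd-same _))) z) d)
min-defined f {as} {o} {σ} {τ = τ} {i} {v} R pos d e (iter {n = n} z r₁ r₂)
  with refl ← trans (sym (trans (e _) (upd-same _))) z
  with υ , s₁ , incr s₂ ← Run-split (clear (1 + o)) r₁
  with s₂′ ← Run-respˡ (minRound-law e s₁) s₂
  with v′ , d′ ← run-defined f (min-ready R) (min-map R) s₂′
  = min-defined f R pos′ d′
      (≗-trans (compile-result f (min-ready R) (min-map R) d′ s₂′) (upd-upd _)) r₂
  where
  pos′ : ∀ k → k < suc i → ∃[ c ] f [ k ∷ map σ as ]⇓ suc c
  pos′ k lt with m<1+n⇒m<n∨m≡n lt
  ... | inj₁ k<i  = pos k k<i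
  ... | inj₂ refl = n , d

-- Both values are what the same compiled program leaves in its output register, the one after the
-- `n` arguments, so determinism of runs settles the matter.
⇓-deterministic : ∀ {n} (f : PartialRecursive n) {as b b′} → f [ as ]⇓ b → f [ as ]⇓ b′ → b ≡ b′
⇓-deterministic {n} f {as} {b} d d′ =
  trans (sym (upd-same (n + 0))) (trans (compile-result f R (map-range as) d′
    (compile-run f R (map-range as) d) (n + 0)) (upd-same (n + 0)))
  where
  R : Ready (range 0 n) (n + 0) (fill (λ _ → 0) 0 as)
  R = ready (range-bounded 0 n) (fill-clean as (λ _ _ → refl))

-- Codes of the diagonal sentences

addᶠ : PartialRecursive 2
addᶠ = rec (proj 0F) (comp sucᶠ (proj 1F ∷ []))

triangleᶠ : PartialRecursive 1
triangleᶠ = rec zeroᶠ (comp addᶠ (comp sucᶠ (proj 0F ∷ []) ∷ proj 1F ∷ []))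

pairᶠ : PartialRecursive 2
pairᶠ = comp addᶠ (comp triangleᶠ (addᶠ ∷ []) ∷ proj 1F ∷ [])

-- The arithmetic behind codes is kept opaque, lest conversion checking compute
-- the (astronomical) codes of concrete formulas.
opaque
  pair : ℕ → ℕ → ℕ
  pair = ⟨_,_⟩

  code : Formula → ℕ
  code = formulaCode

  code-def : ∀ φ → formulaCode φ ≡ code φ
  code-def φ = refl

  code-~ : ∀ φ → code (~ φ) ≡ pair 5 (code φ)
  code-~ φ = refl

  code-∧ : ∀ φ ψ → code (φ ∧ ψ) ≡ pair 6 (pair (code φ) (code ψ))
  code-∧ φ ψ = refl

  code-all : ∀ v φ → code (all v φ) ≡ pair 8 (pair (varCode v) (code φ))
  code-all v φ = refl

  code-ex : ∀ v φ → code (ex v φ) ≡ pair 9 (pair (varCode v) (code φ))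
  code-ex v φ = refl

constᶠ : ∀ {n} → ℕ → PartialRecursive n
constᶠ zero    = comp zeroᶠ []
constᶠ (suc c) = comp sucᶠ (constᶠ c ∷ [])

⇓comp₁ : ∀ {n f g} {as : Vec ℕ n} {b c} → g [ as ]⇓ b → f [ b ∷ [] ]⇓ c → comp f (g ∷ []) [ as ]⇓ c
⇓comp₁ d e = ⇓comp (λ { 0F → d }) e

⇓comp₂ : ∀ {n f g h} {as : Vec ℕ n} {a b c} → g [ as ]⇓ a → h [ as ]⇓ b →
         f [ a ∷ b ∷ [] ]⇓ c → comp f (g ∷ h ∷ []) [ as ]⇓ c
⇓comp₂ d₁ d₂ e = ⇓comp (λ { 0F → d₁ ; 1F → d₂ }) e

⇓add : ∀ m n → addᶠ [ m ∷ n ∷ [] ]⇓ (m + n)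
⇓add zero    n = ⇓rec₀ (⇓proj 0F)
⇓add (suc m) n = ⇓rec₊ (⇓add m n) (⇓comp₁ (⇓proj 1F) ⇓suc)

⇓triangle : ∀ n → triangleᶠ [ n ∷ [] ]⇓ triangle n
⇓triangle zero    = ⇓rec₀ ⇓zero
⇓triangle (suc n) =
  ⇓rec₊ (⇓triangle n) (⇓comp₂ (⇓comp₁ (⇓proj 0F) ⇓suc) (⇓proj 1F) (⇓add (suc n) (triangle n)))

opaque
  unfolding pair

  ⇓pair : ∀ m n → pairᶠ [ m ∷ n ∷ [] ]⇓ pair m n
  ⇓pair m n = ⇓comp₂ (⇓comp₁ (⇓add m n) (⇓triangle (m + n))) (⇓proj 1F) (⇓add (triangle (m + n)) n)

⇓const : ∀ {n} {as : Vec ℕ n} c → constᶠ c [ as ]⇓ c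
⇓const zero    = ⇓comp {bs = []} (λ ()) ⇓zero
⇓const (suc c) = ⇓comp₁ (⇓const c) ⇓suc

-- The code of a formula with one hole is a tower of pairs whose left components are constants,
-- hence given by a list.
wrap : List ℕ → ℕ → ℕ
wrap cs b = foldr pair b cs

wrapᶠ : ∀ {n} → List ℕ → PartialRecursive n → PartialRecursive n
wrapᶠ []       f = f
wrapᶠ (c ∷ cs) f = comp pairᶠ (constᶠ c ∷ wrapᶠ cs f ∷ [])

⇓wrap : ∀ {n} {as : Vec ℕ n} {f b} cs → f [ as ]⇓ b → wrapᶠ cs f [ as ]⇓ wrap cs b
⇓wrap []       d = d
⇓wrap (c ∷ cs) d = ⇓comp₂ (⇓const c) (⇓wrap cs d) (⇓pair c _)

-- The tokens are the elements of P 0.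
tokensBelow : ℕ → Formula
tokensBelow zero    = x ≐ x
tokensBelow (suc n) = ex y (P 0 y ∧ (~ (x ≤₁ y)) ∧ ex x (x ≐ y ∧ tokensBelow n))

-- `tokensBelow n` gives `x` at least `n` tokens strictly below it; renaming `y` back to `x` by an
-- equality lets every layer be the same. Only tokens with some element above them are counted,
-- which is harmless where an event lies above all tokens.
exactly : ℕ → Formula
exactly n = ex x (tokensBelow n) ∧ ~ ex x (tokensBelow (suc n))

-- The path to the hole in `tokensBelow (suc n)`: 9 and 6 stand for `ex` and `∧`, while 1 and 0 are
-- the bound variables `y` and `x`.
layer : List ℕ
layer = 9 ∷ 1 ∷ 6 ∷ code (P 0 y) ∷ 6 ∷ code (~ (x ≤₁ y)) ∷ 9 ∷ 0 ∷ 6 ∷ code (x ≐ y) ∷ []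

code-layer : ∀ n → wrap layer (code (tokensBelow n)) ≡ code (tokensBelow (suc n))
code-layer n
  rewrite code-ex y (P 0 y ∧ (~ (x ≤₁ y)) ∧ ex x (x ≐ y ∧ tokensBelow n))
        | code-∧ (P 0 y) ((~ (x ≤₁ y)) ∧ ex x (x ≐ y ∧ tokensBelow n))
        | code-∧ (~ (x ≤₁ y)) (ex x (x ≐ y ∧ tokensBelow n))
        | code-ex x (x ≐ y ∧ tokensBelow n)
        | code-∧ (x ≐ y) (tokensBelow n) = refl

tokensBelowᶠ : PartialRecursive 1
tokensBelowᶠ = rec (constᶠ (code (x ≐ x))) (wrapᶠ layer (proj 1F))

⇓tokensBelow : ∀ n → tokensBelowᶠ [ n ∷ [] ]⇓ code (tokensBelow n)
⇓tokensBelow zero    = ⇓rec₀ (⇓const (code (x ≐ x)))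
⇓tokensBelow (suc n) = subst (tokensBelowᶠ [ suc n ∷ [] ]⇓_) (code-layer n)
  (⇓rec₊ (⇓tokensBelow n) (⇓wrap layer (⇓proj 1F)))

exactlyᶠ : PartialRecursive 1
exactlyᶠ = wrapᶠ (6 ∷ []) (comp pairᶠ (wrapᶠ (9 ∷ 0 ∷ []) tokensBelowᶠ ∷
  wrapᶠ (5 ∷ 9 ∷ 0 ∷ []) (comp tokensBelowᶠ (sucᶠ ∷ [])) ∷ []))

code-exactly : ∀ n → wrap (6 ∷ []) (pair (wrap (9 ∷ 0 ∷ []) (code (tokensBelow n)))
                                         (wrap (5 ∷ 9 ∷ 0 ∷ []) (code (tokensBelow (suc n))))) ≡
                     code (exactly n)
code-exactly n
  rewrite code-∧ (ex x (tokensBelow n)) (~ ex x (tokensBelow (suc n)))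
        | code-ex x (tokensBelow n)
        | code-~ (ex x (tokensBelow (suc n)))
        | code-ex x (tokensBelow (suc n)) = refl

⇓exactly : ∀ n → exactlyᶠ [ n ∷ [] ]⇓ code (exactly n)
⇓exactly n = subst (exactlyᶠ [ n ∷ [] ]⇓_) (code-exactly n)
  (⇓wrap (6 ∷ []) (⇓comp₂ (⇓wrap (9 ∷ 0 ∷ []) (⇓tokensBelow n))
    (⇓wrap (5 ∷ 9 ∷ 0 ∷ []) (⇓comp₁ ⇓suc (⇓tokensBelow (suc n)))) (⇓pair _ _)))

-- Two quantifiers close every formula, so no condition on `θ` has to be read off its code; they
-- also supply the universal closure that the axioms presuppose.
instantiate : Formula → ℕ → Formula
instantiate θ n = all x (all y (θ ∧ exactly n))

diagonalᶠ : PartialRecursive 1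
diagonalᶠ = wrapᶠ (8 ∷ 0 ∷ 8 ∷ 1 ∷ 6 ∷ []) (comp pairᶠ (proj 0F ∷ exactlyᶠ ∷ []))

code-instantiate : ∀ θ n →
  wrap (8 ∷ 0 ∷ 8 ∷ 1 ∷ 6 ∷ []) (pair (code θ) (code (exactly n))) ≡ code (instantiate θ n)
code-instantiate θ n
  rewrite code-all x (all y (θ ∧ exactly n)) | code-all y (θ ∧ exactly n) | code-∧ θ (exactly n) = refl

⇓diagonal : ∀ θ → diagonalᶠ [ code θ ∷ [] ]⇓ code (instantiate θ (code θ))
⇓diagonal θ = subst (diagonalᶠ [ code θ ∷ [] ]⇓_) (code-instantiate θ (code θ))
  (⇓wrap (8 ∷ 0 ∷ 8 ∷ 1 ∷ 6 ∷ [])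
    (⇓comp₂ (⇓proj 0F) (⇓exactly (code θ)) (⇓pair _ _)))

-- Counter machines

Kind : Set
Kind = Fin 4

pattern incᵏ  = Fin.zero
pattern decᵏ  = Fin.suc Fin.zero
pattern testᵏ = Fin.suc (Fin.suc Fin.zero)
pattern haltᵏ = Fin.suc (Fin.suc (Fin.suc Fin.zero))

data Exec : Kind → ℕ → Reg → Reg → Set where
  inc  : ∀ {r σ σ′} → σ′ r ≡ suc (σ r) → (∀ s → r ≢ s → σ′ s ≡ σ s) → Exec incᵏ r σ σ′
  dec  : ∀ {r σ σ′} → σ r ≡ suc (σ′ r) → (∀ s → r ≢ s → σ′ s ≡ σ s) → Exec decᵏ r σ σ′
  test : ∀ {r σ σ′} → σ r ≡ 0 → σ′ ≗ σ → Exec testᵏ r σ σ′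

-- A counter machine, given by its transitions: a transition can be followed by
-- those that start where it ends.
record Machine : Set where
  field
    size  : ℕ
    kind  : Fin size → Kind
    reg   : Fin size → ℕ
    next  : Fin size → Fin size → Bool
    start : Fin size → Bool

  data Accepts : Fin size → Reg → Set where
    stop : ∀ {l σ} → kind l ≡ haltᵏ → Accepts l σ
    step : ∀ {l l′ σ σ′} → Exec (kind l) (reg l) σ σ′ → T (next l l′) → Accepts l′ σ′ → Accepts l σ

-- Programs as counter machines

module Continuations where

  infix 4 _≟ˢ_ _≟ᴾ_

  _≟ˢ_ : (s t : Stmt) → Dec (s ≡ t)
  _≟ᴾ_ : (p q : Prog) → Dec (p ≡ q)

  incr r ≟ˢ incr s = map′ (cong incr) (λ { refl → refl }) (r ≟ⁿ s)
  incr _ ≟ˢ loop _ _ = no λ ()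
  loop _ _ ≟ˢ incr _ = no λ ()
  loop r p ≟ˢ loop s q =
    map′ (λ (e , f) → cong₂ loop e f) (λ { refl → refl , refl }) (r ≟ⁿ s ×-dec p ≟ᴾ q)

  [] ≟ᴾ [] = yes refl
  [] ≟ᴾ (_ ∷ _) = no λ ()
  (_ ∷ _) ≟ᴾ [] = no λ ()
  (s ∷ p) ≟ᴾ (t ∷ q) =
    map′ (λ (e , f) → cong₂ _∷_ e f) (λ { refl → refl , refl }) (s ≟ˢ t ×-dec p ≟ᴾ q)

  record Transition : Set where
    constructor transition
    field
      source : Prog
      kind   : Kind
      reg    : ℕ
      target : Prog

  open Transition

  transitions : Prog → List Transition
  transitions []             = transition [] haltᵏ 0 [] ∷ []
  transitions (incr r ∷ k)   = transition (incr r ∷ k) incᵏ r k ∷ []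
  transitions (loop r q ∷ k) =
    transition (loop r q ∷ k) testᵏ r k ∷ transition (loop r q ∷ k) decᵏ r (q ++ loop r q ∷ k) ∷ []

  -- The states of the machine of a program are the continuations still to be run.
  states : Prog → List Prog
  states []             = [] ∷ []
  states (incr r ∷ k)   = (incr r ∷ k) ∷ states k
  states (loop r q ∷ k) = (loop r q ∷ k) ∷ states k ++ mapᴸ (_++ loop r q ∷ k) (states q)

  self∈states : ∀ p → p ∈ states p
  self∈states []             = here refl
  self∈states (incr r ∷ k)   = here refl
  self∈states (loop r q ∷ k) = here refl

  -- A state inside a loop is `u ++ L` with `L` the loop and what follows it. Steps of `u` stay
  -- among the states of the body; when `u` is empty, the transitions are those of `L` itself.
  states-closed : ∀ p {s t} → s ∈ states p → t ∈ transitions s → target t ∈ states p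
  states-closed [] (here refl) (here refl) = here refl
  states-closed (incr r ∷ k) (here refl) (here refl) = there (self∈states k)
  states-closed (incr r ∷ k) (there s∈) t∈ = there (states-closed k s∈ t∈)
  states-closed (loop r q ∷ k) (here refl) t∈ = loop-closed t∈
    where
    loop-closed : ∀ {t} → t ∈ transitions (loop r q ∷ k) → target t ∈ states (loop r q ∷ k)
    loop-closed (here refl)         = there (∈-++⁺ˡ (self∈states k))
    loop-closed (there (here refl)) =
      there (∈-++⁺ʳ (states k) (∈-map⁺ (_++ loop r q ∷ k) (self∈states q)))
  states-closed (loop r q ∷ k) {s} (there s∈) t∈ with ∈-++⁻ (states k) s∈
  ... | inj₁ s∈k = there (∈-++⁺ˡ (states-closed k s∈k t∈))
  ... | inj₂ s∈q with ∈-map⁻ (_++ loop r q ∷ k) s∈q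
  ... | u , u∈q , refl = body u u∈q t∈
    where
    L = loop r q ∷ k
    inBody : ∀ {u} → u ∈ states q → u ++ L ∈ states L
    inBody u∈ = there (∈-++⁺ʳ (states k) (∈-map⁺ (_++ L) u∈))
    body : ∀ u {t} → u ∈ states q → t ∈ transitions (u ++ L) → target t ∈ states L
    body [] u∈ (here refl)         = there (∈-++⁺ˡ (self∈states k))
    body [] u∈ (there (here refl)) = inBody (self∈states q)
    body (incr r′ ∷ u) u∈ (here refl) = inBody (states-closed q u∈ (here refl))
    body (loop r′ q′ ∷ u) u∈ (here refl) = inBody (states-closed q u∈ (here refl))
    body (loop r′ q′ ∷ u) u∈ (there (here refl)) =
      subst (_∈ states L) (++-assoc q′ (loop r′ q′ ∷ u) L)
        (inBody (states-closed q u∈ (there (here refl))))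

  []∈states : ∀ p → [] ∈ states p
  []∈states []             = here refl
  []∈states (incr r ∷ k)   = there ([]∈states k)
  []∈states (loop r q ∷ k) = there (∈-++⁺ˡ ([]∈states k))

  transition-source : ∀ p {t} → t ∈ transitions p → source t ≡ p
  transition-source []             (here refl)         = refl
  transition-source (incr r ∷ k)   (here refl)         = refl
  transition-source (loop r q ∷ k) (here refl)         = refl
  transition-source (loop r q ∷ k) (there (here refl)) = refl

  halted : ∀ {p t} → t ∈ transitions p → kind t ≡ haltᵏ → p ≡ []
  halted {[]}           t∈                  h = refl
  halted {incr r ∷ k}   (here refl)         ()
  halted {loop r q ∷ k} (here refl)         ()
  halted {loop r q ∷ k} (there (here refl)) ()

  upd-intro : ∀ {σ σ′ r v} → σ′ r ≡ v → (∀ s → r ≢ s → σ′ s ≡ σ s) → σ′ ≗ upd σ r v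
  upd-intro {r = r} e f s with r ≟ⁿ s
  ... | yes refl = trans e (sym (upd-same r))
  ... | no r≢s   = trans (f s r≢s) (sym (upd-other r≢s))

  run-step : ∀ {p t σ σ′ υ} → t ∈ transitions p → Exec (kind t) (reg t) σ σ′ →
             Run (target t) σ′ υ → Run p σ υ
  run-step {[]}           (here refl) ()
  run-step {incr r ∷ k}   (here refl) (inc e f)  d = incr (Run-respˡ (upd-intro e f) d)
  run-step {loop r q ∷ k} (here refl) (test e f) d = exit e (Run-respˡ f d)
  run-step {loop r q ∷ k} (there (here refl)) (dec e f) d
    with τ , d₁ , d₂ ← Run-split q d = iter e (Run-respˡ (upd-intro refl f) d₁) d₂

  module _ (p₀ : Prog) where

    private
      table : List Transition
      table = concatMap transitions (states p₀)

      at : Fin (length table) → Transition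
      at = lookupᴸ table

    transitionMachine : Machine
    transitionMachine = record
      { size  = length table
      ; kind  = λ l → kind (at l)
      ; reg   = λ l → reg (at l)
      ; next  = λ l l′ → isYes (target (at l) ≟ᴾ source (at l′))
      ; start = λ l → isYes (p₀ ≟ᴾ source (at l))
      }

    open Machine transitionMachine using (Accepts; stop; step; start)

    private
      own : ∀ l → at l ∈ transitions (source (at l))
      own l with Any.satisfied (∈-concatMap⁻ transitions {xs = states p₀} (∈-lookup l))
      ... | p , t∈ = subst (λ q → at l ∈ transitions q) (sym (transition-source p t∈)) t∈

      AcceptsFrom : Prog → Reg → Set
      AcceptsFrom p σ = ∃[ l ] p ≡ source (at l) × Accepts l σ

      label : ∀ {s t} → s ∈ states p₀ → t ∈ transitions s → ∃[ l ] t ≡ at l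
      label s∈ t∈ = Any.index i , lookup-index i
        where i = ∈-concatMap⁺ transitions (Any.map (λ { refl → t∈ }) s∈)

      take : ∀ {s t σ σ′} → s ∈ states p₀ → t ∈ transitions s → s ≡ source t →
             Exec (kind t) (reg t) σ σ′ → AcceptsFrom (target t) σ′ → AcceptsFrom s σ
      take s∈ t∈ s≡ e (l′ , eq , acc) with l , refl ← label s∈ t∈ =
        l , s≡ , step e (fromWitness eq) acc

      -- The continuation `k` is kept general because an iteration runs the body with the whole loop
      -- as its continuation; acceptance from there comes from the run of the remaining rounds.
      accepts : ∀ p k {σ σ′} → Run p σ σ′ → p ++ k ∈ states p₀ →
                (∀ {τ} → τ ≗ σ′ → AcceptsFrom k τ) → ∀ {τ} → τ ≗ σ → AcceptsFrom (p ++ k) τ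
      accepts [] k (done e) s∈ K f = K (≗-trans f e)
      accepts (incr r ∷ p) k (incr d) s∈ K {τ} f =
        take s∈ (here refl) refl (inc (upd-same r) (λ s → upd-other))
          (accepts p k d (states-closed p₀ s∈ (here refl)) K (upd-cong (cong suc (f r)) f))
      accepts (loop r q ∷ p) k (exit e d) s∈ K f =
        take s∈ (here refl) refl (test (trans (f r) e) (λ _ → refl))
          (accepts p k d (states-closed p₀ s∈ (here refl)) K f)
      accepts (loop r q ∷ p) k {σ} (iter {n = n} e d d′) s∈ K {τ} f =
        take s∈ (there (here refl)) refl
          (dec (trans (f r) (trans e (cong suc (sym (upd-same r))))) (λ s → upd-other {v = n}))
          (accepts q (loop r q ∷ p ++ k) d (states-closed p₀ s∈ (there (here refl)))
            (accepts (loop r q ∷ p) k d′ s∈ K) (upd-cong refl f))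

      run : ∀ {l σ} → Accepts l σ → ∃[ σ′ ] Run (source (at l)) σ σ′
      run {l} {σ} (stop h) = σ , subst (λ p → Run p σ σ) (sym (halted (own l) h)) (done λ _ → refl)
      run {l} (step {l′ = l′} e n a) with υ , d ← run a =
        υ , run-step (own l) e (subst (λ p → Run p _ υ) (sym (toWitness n)) d)

    run⇒accepts : ∀ {σ σ′} → Run p₀ σ σ′ → ∃[ l ] T (start l) × Accepts l σ
    run⇒accepts {σ} {σ′} d
      with l , p≡ , a ← accepts p₀ [] d (subst (_∈ states p₀) (sym (++-identityʳ p₀)) (self∈states p₀))
                          (λ {τ} _ → let l , t≡ = label ([]∈states p₀) (here refl) in
                            l , cong source t≡ , stop (cong kind (sym t≡)))
                          (λ _ → refl)
      = l , fromWitness (trans (sym (++-identityʳ p₀)) p≡) , a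

    accepts⇒run : ∀ {l σ} → T (start l) → Accepts l σ → ∃[ σ′ ] Run p₀ σ σ′
    accepts⇒run {l} {σ} s a = subst (λ p → ∃[ σ′ ] Run p σ σ′) (sym (toWitness s)) (run a)

  opaque
    machine : Prog → Machine
    machine = transitionMachine

    run-accepts : ∀ p {σ σ′} → Run p σ σ′ →
                  ∃[ l ] T (Machine.start (machine p) l) × Machine.Accepts (machine p) l σ
    run-accepts = run⇒accepts

    accepts-run : ∀ p {l σ} → T (Machine.start (machine p) l) → Machine.Accepts (machine p) l σ →
                  ∃[ σ′ ] Run p σ σ′
    accepts-run = accepts⇒run

open Continuations using (machine; run-accepts; accepts-run)

-- The theory of accepting runs

module Orders (M : Structure) where
  open Structure M

  infix 4 _≤¹_ _≤²_ _≤³_ _≈³_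
  _≤¹_ _≤²_ _≤³_ _≈³_ Inverted : Universe → Universe → Set
  a ≤¹ b = T (le₁ a b)
  a ≤² b = T (le₂ a b)
  a ≤³ b = T (le₃ a b)
  a ≈³ b = a ≤³ b × b ≤³ a
  Inverted a b = ¬ (b ≤¹ a) × ¬ (a ≤² b)

assign : ∀ M → Structure.Universe M → Structure.Universe M → Assignment M
assign M a b = _[_↦_] M (_[_↦_] M (λ _ → a) x a) y b

module Logic (N : Machine) where
  open Machine N

  -- An item is a transition, or zero for a token, which increments register 0.
  Item : Set
  Item = Fin (suc size)

  -- An element is a main element or a copy (0F or 1F), coloured modulo 3.
  Label : Set
  Label = Fin 2 × Fin 3 × Item

  side : Label → Fin 2
  side (s , _ , _) = s

  colour : Label → Fin 3
  colour (_ , c , _) = c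

  item : Label → Item
  item (_ , _ , i) = i

  labels : List Label
  labels = cartesianProduct (allFin 2) (cartesianProduct (allFin 3) (allFin (suc size)))

  ∈labels : ∀ a → a ∈ labels
  ∈labels (s , c , i) = ∈-cartesianProduct⁺ (∈-allFin s) (∈-cartesianProduct⁺ (∈-allFin c) (∈-allFin i))

  -- The shift by one leaves `P 0` to the tokens, whose symbol must be the same for all machines.
  symbol : Label → ℕ
  symbol (s , c , i) = suc (toℕ (combine s (combine c i)))

  symbol-injective : ∀ a b → symbol a ≡ symbol b → a ≡ b
  symbol-injective (s , c , i) (s′ , c′ , i′) e
    with refl , e′ ← combine-injective s (combine c i) s′ (combine c′ i′) (toℕ-injective (suc-injective e))
    with refl , refl ← combine-injective c i c′ i′ e′ = refl

  -- Relations between labels as formulas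

  opaque
    ⋁ : ∀ {A : Set} → List A → (A → Formula) → Formula
    ⋁ []       f = ~ (x ≐ x)
    ⋁ (a ∷ as) f = f a ∨ ⋁ as f

    ⋁-intro : ∀ {M ρ} {A : Set} {as : List A} {f a} → a ∈ as → Holds M ρ (f a) → Holds M ρ (⋁ as f)
    ⋁-intro (here refl) h = inj₁ h
    ⋁-intro (there a∈)  h = inj₂ (⋁-intro a∈ h)

    ⋁-elim : ∀ {M ρ} {A : Set} (as : List A) {f} → Holds M ρ (⋁ as f) → ∃[ a ] Holds M ρ (f a)
    ⋁-elim []       h        = ⊥-elim (h refl)
    ⋁-elim (a ∷ as) (inj₁ h) = a , h
    ⋁-elim (a ∷ as) (inj₂ h) = ⋁-elim as h

  -- There are finitely many labels, so a decidable relation between them is a disjunction over the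
  -- pairs that it contains, written with unary symbols only.
  related : {R : Label → Label → Set} → (∀ a b → Dec (R a b)) → Var → Var → Formula
  related R? u v = ⋁ (cartesianProduct labels labels) λ (a , b) →
    if does (R? a b) then P (symbol a) u ∧ P (symbol b) v else (~ (x ≐ x))

  related-intro : ∀ {M ρ} {R : Label → Label → Set} (R? : ∀ a b → Dec (R a b)) {u v a b} → R a b →
    T (Structure.pred M (symbol a) (ρ u)) → T (Structure.pred M (symbol b) (ρ v)) →
    Holds M ρ (related R? u v)
  related-intro {M} {ρ} R? {u} {v} {a} {b} r p q =
    ⋁-intro (∈-cartesianProduct⁺ (∈labels a) (∈labels b)) h
    where
    h : Holds M ρ (if does (R? a b) then P (symbol a) u ∧ P (symbol b) v else (~ (x ≐ x)))
    h with R? a b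
    ... | yes _  = p , q
    ... | no ¬r = ⊥-elim (¬r r)

  related-elim : ∀ {M ρ} {R : Label → Label → Set} (R? : ∀ a b → Dec (R a b)) {u v} →
    Holds M ρ (related R? u v) →
    ∃[ a ] ∃[ b ] R a b × T (Structure.pred M (symbol a) (ρ u)) × T (Structure.pred M (symbol b) (ρ v))
  related-elim {M} R? h with ⋁-elim {M} (cartesianProduct labels labels) h
  ... | (a , b) , h′ with R? a b
  ...   | yes r = a , b , r , h′
  ...   | no _  = ⊥-elim (h′ refl)

  infix  8 _≈₃_ _<₁_ _<₂_ _<₃_
  infixr 7 _&_
  infixr 6 _∥_
  infixr 5 _⇒_

  -- An intermediate syntax that remembers the relation behind each atom. Under `Sat` a formula is a
  -- proposition about labels and orders, and each conjunct of `axioms` unfolds to a field of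
  -- `Good`.
  data Φ : Set₁ where
    _⟨_⟩⟨_⟩     : {R : Label → Label → Set} → (∀ a b → Dec (R a b)) → Var → Var → Φ
    ⌜_⌝         : Formula → Φ
    _&_ _∥_ _⇒_ : Φ → Φ → Φ
    ∀′ ∃′       : Var → Φ → Φ

  translate : Φ → Formula
  translate (R? ⟨ u ⟩⟨ v ⟩) = related R? u v
  translate ⌜ φ ⌝           = φ
  translate (φ & ψ)         = translate φ ∧ translate ψ
  translate (φ ∥ ψ)         = translate φ ∨ translate ψ
  translate (φ ⇒ ψ)         = ~ translate φ ∨ translate ψ
  translate (∀′ v φ)        = all v (translate φ)
  translate (∃′ v φ)        = ex v (translate φ)

  _<₁_ _<₂_ _<₃_ _≈₃_ inverted : Var → Var → Φ
  u <₁ v = ⌜ ~ (v ≤₁ u) ⌝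
  u <₂ v = ⌜ ~ (v ≤₂ u) ⌝
  u <₃ v = ⌜ ~ (v ≾₃ u) ⌝
  u ≈₃ v = ⌜ u ≾₃ v ∧ v ≾₃ u ⌝
  inverted u v = u <₁ v & v <₂ u

  kindOf : Item → Kind
  kindOf 0F          = incᵏ
  kindOf (Fin.suc l) = kind l

  regOf : Item → ℕ
  regOf 0F          = 0
  regOf (Fin.suc l) = reg l

  nextOf : Item → Item → Bool
  nextOf (Fin.suc l) (Fin.suc l′) = next l l′
  nextOf _           _            = false

  startOf : Item → Bool
  startOf 0F          = false
  startOf (Fin.suc l) = start l

  cycle : Fin 3 → Fin 3
  cycle 0F = 1F
  cycle 1F = 2F
  cycle 2F = 0F

  IsToken IsEvent Working ActiveCopy Starting : Label → Set
  IsToken a    = side a ≡ 0F × item a ≡ 0F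
  IsEvent a    = side a ≡ 0F × item a ≢ 0F
  Working a    = IsEvent a × kindOf (item a) ≢ haltᵏ
  ActiveCopy a = side a ≡ 1F × item a ≢ 0F × kindOf (item a) ≢ haltᵏ
  Starting a   = T (startOf (item a))

  Does : Kind → Label → Set
  Does k a = side a ≡ 0F × kindOf (item a) ≡ k

  Same SameOp Next CopyOf : Label → Label → Set
  Same a b   = colour a ≡ colour b × item a ≡ item b
  SameOp a b = side a ≡ 0F × side b ≡ 0F × kindOf (item a) ≡ kindOf (item b) ×
               regOf (item a) ≡ regOf (item b)
  Next a b   = colour b ≡ cycle (colour a) × T (nextOf (item a) (item b))
  CopyOf b a = side b ≡ 1F × Same b a

  Matching : Kind → Kind → Label → Label → Set
  Matching k k′ a b = Does k a × Does k′ b × regOf (item a) ≡ regOf (item b)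

  isToken? : ∀ a → Dec (IsToken a)
  isToken? a = side a ≟ 0F ×-dec item a ≟ 0F

  isEvent? : ∀ a → Dec (IsEvent a)
  isEvent? a = side a ≟ 0F ×-dec ¬? (item a ≟ 0F)

  working? : ∀ a → Dec (Working a)
  working? a = isEvent? a ×-dec ¬? (kindOf (item a) ≟ haltᵏ)

  activeCopy? : ∀ a → Dec (ActiveCopy a)
  activeCopy? a = side a ≟ 1F ×-dec ¬? (item a ≟ 0F) ×-dec ¬? (kindOf (item a) ≟ haltᵏ)

  starting? : ∀ a → Dec (Starting a)
  starting? a = T? _

  does? : ∀ k a → Dec (Does k a)
  does? k a = side a ≟ 0F ×-dec kindOf (item a) ≟ k

  same? : ∀ a b → Dec (Same a b)
  same? a b = colour a ≟ colour b ×-dec item a ≟ item b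

  sameOp? : ∀ a b → Dec (SameOp a b)
  sameOp? a b = side a ≟ 0F ×-dec side b ≟ 0F ×-dec kindOf (item a) ≟ kindOf (item b) ×-dec
                regOf (item a) ≟ⁿ regOf (item b)

  next? : ∀ a b → Dec (Next a b)
  next? a b = colour b ≟ cycle (colour a) ×-dec T? _

  copyOf? : ∀ b a → Dec (CopyOf b a)
  copyOf? b a = side b ≟ 1F ×-dec same? b a

  matching? : ∀ k k′ a b → Dec (Matching k k′ a b)
  matching? k k′ a b = does? k a ×-dec does? k′ b ×-dec regOf (item a) ≟ⁿ regOf (item b)

  is : {Q : Label → Set} → (∀ a → Dec (Q a)) → Var → Φ
  is Q? v = (λ a _ → Q? a) ⟨ v ⟩⟨ v ⟩

  axioms : Φ
  axioms =
      (is isEvent? x ⇒ is isEvent? y ⇒ x <₁ y ⇒ x <₂ y)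
    & (is activeCopy? x ⇒ is isEvent? y ⇒ inverted x y ⇒ same? ⟨ x ⟩⟨ y ⟩ & x ≈₃ y ∥ next? ⟨ x ⟩⟨ y ⟩)
    -- `SameOp` is confined to main elements, since a copy shares the class and the item of its
    -- original.
    & (sameOp? ⟨ x ⟩⟨ y ⟩ ⇒ x ≈₃ y ⇒ ⌜ x ≐ y ⌝)
    & (matching? decᵏ incᵏ ⟨ x ⟩⟨ y ⟩ ⇒ x ≈₃ y ⇒ y <₁ x)
    -- Strict for increments, while the next conjunct is weak for decrements: together they keep an
    -- increment before the test and a decrement after it out of a common class.
    & (matching? testᵏ incᵏ ⟨ x ⟩⟨ y ⟩ ⇒ y <₁ x ⇒ y <₃ x)
    & (matching? testᵏ decᵏ ⟨ x ⟩⟨ y ⟩ ⇒ x <₁ y ⇒ ⌜ x ≾₃ y ⌝)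
    & (is isToken? x ⇒ is isEvent? y ⇒ x <₁ y)
    & (is working? x ⇒ ∃′ y (copyOf? ⟨ y ⟩⟨ x ⟩ & y ≈₃ x & inverted y x))
    & (is activeCopy? x ⇒ ∃′ y (is isEvent? y & next? ⟨ x ⟩⟨ y ⟩ & inverted x y))
    -- Counters may be positive on halting, so an increment may stay unmatched provided that no test
    -- of its register comes after it.
    & (is (does? incᵏ) x ⇒ ∃′ y (matching? decᵏ incᵏ ⟨ y ⟩⟨ x ⟩ & y ≈₃ x) ∥
                           ∀′ y (matching? testᵏ incᵏ ⟨ y ⟩⟨ x ⟩ ⇒ ⌜ y ≤₁ x ⌝))
    & (is (does? decᵏ) x ⇒ ∃′ y (matching? decᵏ incᵏ ⟨ x ⟩⟨ y ⟩ & x ≈₃ y))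
    & ∃′ x (is isEvent? x)
    -- This makes the least event a starting one without having to define "least" inside the
    -- formula.
    & (is isEvent? x ⇒ is starting? x ∥ ∃′ y (is isEvent? y & y <₁ x))
    & (⌜ P 0 x ⌝ ⇒ is isToken? x)
    & (is isToken? x ⇒ ⌜ P 0 x ⌝)

  _≟ᴸ_ : (a b : Label) → Dec (a ≡ b)
  _≟ᴸ_ = ≡-dec _≟_ (≡-dec _≟_ _≟_)

  labelled : Formula
  labelled = ⋁ labels (λ a → P (symbol a) x) ∧ ~ related (λ a b → ¬? (a ≟ᴸ b)) x x

  theory : Formula
  theory = labelled ∧ translate axioms

  -- Satisfaction in terms of labels

  module Semantics (M : Structure) (lab : Structure.Universe M → Label)
    (sound    : ∀ u → T (Structure.pred M (symbol (lab u)) u))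
    (complete : ∀ a u → T (Structure.pred M (symbol a) u) → a ≡ lab u) where

    open Structure M

    Sat : Assignment M → Φ → Set
    Sat ρ (_⟨_⟩⟨_⟩ {R} _ u v) = R (lab (ρ u)) (lab (ρ v))
    Sat ρ ⌜ φ ⌝    = Holds M ρ φ
    Sat ρ (φ & ψ)  = Sat ρ φ × Sat ρ ψ
    Sat ρ (φ ∥ ψ)  = Sat ρ φ ⊎ Sat ρ ψ
    Sat ρ (φ ⇒ ψ)  = Sat ρ φ → Sat ρ ψ
    Sat ρ (∀′ v φ) = ∀ a → Sat (_[_↦_] M ρ v a) φ
    Sat ρ (∃′ v φ) = ∃[ a ] Sat (_[_↦_] M ρ v a) φ

    -- Implication is translated as `~ φ ∨ ψ`, which follows from a function only if `φ` is decided;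
    -- finiteness of the universe decides it.
    holds? : ∀ φ ρ → Dec (Holds M ρ φ)
    holds? (u ≐ v)   ρ = ρ u ≟ ρ v
    holds? (u ≤₁ v)  ρ = T? _
    holds? (u ≤₂ v)  ρ = T? _
    holds? (u ≾₃ v)  ρ = T? _
    holds? (P i v)   ρ = T? _
    holds? (~ φ)     ρ = ¬? (holds? φ ρ)
    holds? (φ ∧ ψ)   ρ = holds? φ ρ ×-dec holds? ψ ρ
    holds? (φ ∨ ψ)   ρ = holds? φ ρ ⊎-dec holds? ψ ρ
    holds? (all v φ) ρ = all? (λ a → holds? φ (_[_↦_] M ρ v a))
    holds? (ex v φ)  ρ = any? (λ a → holds? φ (_[_↦_] M ρ v a))

    Sat⇒Holds : ∀ φ {ρ} → Sat ρ φ → Holds M ρ (translate φ)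
    Holds⇒Sat : ∀ φ {ρ} → Holds M ρ (translate φ) → Sat ρ φ

    Sat⇒Holds (R? ⟨ u ⟩⟨ v ⟩) {ρ} s =
      related-intro R? s (sound (ρ u)) (sound (ρ v))
    Sat⇒Holds ⌜ φ ⌝    s        = s
    Sat⇒Holds (φ & ψ)  (s , t)  = Sat⇒Holds φ s , Sat⇒Holds ψ t
    Sat⇒Holds (φ ∥ ψ)  (inj₁ s) = inj₁ (Sat⇒Holds φ s)
    Sat⇒Holds (φ ∥ ψ)  (inj₂ s) = inj₂ (Sat⇒Holds ψ s)
    Sat⇒Holds (φ ⇒ ψ)  {ρ} s with holds? (translate φ) ρ
    ... | yes h = inj₂ (Sat⇒Holds ψ (s (Holds⇒Sat φ h)))
    ... | no ¬h = inj₁ ¬h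
    Sat⇒Holds (∀′ v φ) s a       = Sat⇒Holds φ (s a)
    Sat⇒Holds (∃′ v φ) (a , s)   = a , Sat⇒Holds φ s

    Holds⇒Sat (R? ⟨ u ⟩⟨ v ⟩) {ρ} h with related-elim R? h
    ... | a , b , r , p , q rewrite complete a (ρ u) p | complete b (ρ v) q = r
    Holds⇒Sat ⌜ φ ⌝    h        = h
    Holds⇒Sat (φ & ψ)  (h , k)  = Holds⇒Sat φ h , Holds⇒Sat ψ k
    Holds⇒Sat (φ ∥ ψ)  (inj₁ h) = inj₁ (Holds⇒Sat φ h)
    Holds⇒Sat (φ ∥ ψ)  (inj₂ h) = inj₂ (Holds⇒Sat ψ h)
    Holds⇒Sat (φ ⇒ ψ)  (inj₁ ¬h) s = ⊥-elim (¬h (Sat⇒Holds φ s))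
    Holds⇒Sat (φ ⇒ ψ)  (inj₂ h) s = Holds⇒Sat ψ h
    Holds⇒Sat (∀′ v φ) h a      = Holds⇒Sat φ (h a)
    Holds⇒Sat (∃′ v φ) (a , h)  = a , Holds⇒Sat φ h

    Holds-labelled : ∀ ρ → Holds M ρ labelled
    Holds-labelled ρ = ⋁-intro (∈labels (lab (ρ x))) (sound (ρ x)) , unique
      where
      unique : ¬ Holds M ρ (related (λ a b → ¬? (a ≟ᴸ b)) x x)
      unique h with related-elim (λ a b → ¬? (a ≟ᴸ b)) h
      ... | a , b , a≢b , p , q = a≢b (trans (complete a (ρ x) p) (sym (complete b (ρ x) q)))

  labelled⇒label : ∀ M → (∀ a b → Holds M (assign M a b) labelled) →
    ∃[ lab ] (∀ u → T (Structure.pred M (symbol (lab u)) u)) ×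
             (∀ a u → T (Structure.pred M (symbol a) u) → a ≡ lab u)
  labelled⇒label M h = lab , sound , complete
    where
    open Structure M
    labelOf : ∀ u → ∃[ a ] T (pred (symbol a) u)
    labelOf u = ⋁-elim labels (proj₁ (h u u))
    lab : Universe → Label
    lab u = proj₁ (labelOf u)
    sound : ∀ u → T (pred (symbol (lab u)) u)
    sound u = proj₂ (labelOf u)
    complete : ∀ a u → T (pred (symbol a) u) → a ≡ lab u
    complete a u p with a ≟ᴸ lab u
    ... | yes e = e
    ... | no ne = ⊥-elim (proj₂ (h u u)
            (related-intro (λ a b → ¬? (a ≟ᴸ b)) {x} {x} {a} {lab u} ne p (sound u)))

  record Good (M : Structure) (lab : Structure.Universe M → Label) : Set where
    open Structure M using (Universe; pred)
    open Orders M

    field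
      events-agree    : ∀ a b → IsEvent (lab a) → IsEvent (lab b) → ¬ (b ≤¹ a) → ¬ (b ≤² a)
      copy-inverts    : ∀ d b → ActiveCopy (lab d) → IsEvent (lab b) → Inverted d b →
                        (Same (lab d) (lab b) × d ≈³ b) ⊎ Next (lab d) (lab b)
      sameOp-unique   : ∀ a b → SameOp (lab a) (lab b) → a ≈³ b → a ≡ b
      inc-before-dec  : ∀ a b → Matching decᵏ incᵏ (lab a) (lab b) → a ≈³ b → ¬ (a ≤¹ b)
      inc-before-test : ∀ a b → Matching testᵏ incᵏ (lab a) (lab b) → ¬ (a ≤¹ b) → ¬ (a ≤³ b)
      dec-after-test  : ∀ a b → Matching testᵏ decᵏ (lab a) (lab b) → ¬ (b ≤¹ a) → a ≤³ b
      tokens-first    : ∀ a b → IsToken (lab a) → IsEvent (lab b) → ¬ (b ≤¹ a)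
      has-copy        : ∀ a → Working (lab a) →
                        ∃[ d ] CopyOf (lab d) (lab a) × d ≈³ a × Inverted d a
      copy-has-next   : ∀ d → ActiveCopy (lab d) →
                        ∃[ b ] IsEvent (lab b) × Next (lab d) (lab b) × Inverted d b
      inc-matched     : ∀ a → Does incᵏ (lab a) →
                        (∃[ b ] Matching decᵏ incᵏ (lab b) (lab a) × b ≈³ a) ⊎
                        (∀ b → Matching testᵏ incᵏ (lab b) (lab a) → b ≤¹ a)
      dec-matched     : ∀ a → Does decᵏ (lab a) → ∃[ b ] Matching decᵏ incᵏ (lab a) (lab b) × a ≈³ b
      has-event       : ∃[ a ] IsEvent (lab a)
      first-starts    : ∀ a → IsEvent (lab a) →
                        Starting (lab a) ⊎ ∃[ b ] IsEvent (lab b) × ¬ (a ≤¹ b)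
      marked⇒token    : ∀ a → T (pred 0 a) → IsToken (lab a)
      token⇒marked    : ∀ a → IsToken (lab a) → T (pred 0 a)

  open Good

  module _ {M : Structure} {lab : Structure.Universe M → Label}
    (sound    : ∀ u → T (Structure.pred M (symbol (lab u)) u))
    (complete : ∀ a u → T (Structure.pred M (symbol a) u) → a ≡ lab u) where

    open Semantics M lab sound complete

    Good⇒theory : Good M lab → ∀ ρ → Holds M ρ theory
    Good⇒theory G ρ = Holds-labelled ρ , Sat⇒Holds axioms
      ( events-agree G (ρ x) (ρ y)
      , copy-inverts G (ρ x) (ρ y)
      , sameOp-unique G (ρ x) (ρ y)
      , inc-before-dec G (ρ x) (ρ y)
      , inc-before-test G (ρ x) (ρ y)
      , dec-after-test G (ρ x) (ρ y)
      , tokens-first G (ρ x) (ρ y)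
      , has-copy G (ρ x)
      , copy-has-next G (ρ x)
      , inc-matched G (ρ x)
      , dec-matched G (ρ x)
      , has-event G
      , first-starts G (ρ x)
      , marked⇒token G (ρ x)
      , token⇒marked G (ρ x)
      )

  theory⇒Good : ∀ {M} → (∀ a b → Holds M (assign M a b) theory) → ∃[ lab ] Good M lab
  theory⇒Good {M} h with lab , sound , complete ← labelled⇒label M (λ a b → proj₁ (h a b)) = lab , record
    { events-agree    = λ a b → let (p , _) = ax a b in p
    ; copy-inverts    = λ a b → let (_ , p , _) = ax a b in p
    ; sameOp-unique   = λ a b → let (_ , _ , p , _) = ax a b in p
    ; inc-before-dec  = λ a b → let (_ , _ , _ , p , _) = ax a b in p
    ; inc-before-test = λ a b → let (_ , _ , _ , _ , p , _) = ax a b in p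
    ; dec-after-test  = λ a b → let (_ , _ , _ , _ , _ , p , _) = ax a b in p
    ; tokens-first    = λ a b → let (_ , _ , _ , _ , _ , _ , p , _) = ax a b in p
    ; has-copy        = λ a → let (_ , _ , _ , _ , _ , _ , _ , p , _) = ax a a in p
    ; copy-has-next   = λ a → let (_ , _ , _ , _ , _ , _ , _ , _ , p , _) = ax a a in p
    ; inc-matched     = λ a → let (_ , _ , _ , _ , _ , _ , _ , _ , _ , p , _) = ax a a in p
    ; dec-matched     = λ a → let (_ , _ , _ , _ , _ , _ , _ , _ , _ , _ , p , _) = ax a a in p
    ; has-event       = let (_ , _ , _ , _ , _ , _ , _ , _ , _ , _ , _ , p , _) = ax Fin.zero Fin.zero in p
    ; first-starts    = λ a → let (_ , _ , _ , _ , _ , _ , _ , _ , _ , _ , _ , _ , p , _) = ax a a in p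
    ; marked⇒token    = λ a → let (_ , _ , _ , _ , _ , _ , _ , _ , _ , _ , _ , _ , _ , p , _) = ax a a in p
    ; token⇒marked    = λ a → let (_ , _ , _ , _ , _ , _ , _ , _ , _ , _ , _ , _ , _ , _ , p) = ax a a in p
    }
    where
    ax = λ a b → Semantics.Holds⇒Sat M lab sound complete axioms (proj₂ (h a b))

-- Accepting runs from models

bump : {A : Set} → Dec A → ℕ → ℕ
bump (yes _) k = suc k
bump (no _)  k = k

# : ∀ {n} {Q : Fin n → Set} → (∀ i → Dec (Q i)) → ℕ
# {zero}  Q? = 0
# {suc n} Q? = bump (Q? 0F) (# (Q? ∘ Fin.suc))

#-mono : ∀ {n} {Q R : Fin n → Set} (Q? : ∀ i → Dec (Q i)) (R? : ∀ i → Dec (R i)) →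
         (∀ i → Q i → R i) → # Q? ≤ # R?
#-mono {zero}  Q? R? f = z≤n
#-mono {suc n} Q? R? f with Q? 0F | R? 0F | #-mono (Q? ∘ Fin.suc) (R? ∘ Fin.suc) (f ∘ Fin.suc)
... | yes _ | yes _ | le = s≤s le
... | yes q | no ¬r | _  = ⊥-elim (¬r (f 0F q))
... | no _  | yes _ | le = m≤n⇒m≤1+n le
... | no _  | no _  | le = le

#-cong : ∀ {n} {Q R : Fin n → Set} (Q? : ∀ i → Dec (Q i)) (R? : ∀ i → Dec (R i)) →
         (∀ i → Q i → R i) → (∀ i → R i → Q i) → # Q? ≡ # R?
#-cong Q? R? f g = ≤-antisym (#-mono Q? R? f) (#-mono R? Q? g)

#-add : ∀ {n} {Q R : Fin n → Set} (Q? : ∀ i → Dec (Q i)) (R? : ∀ i → Dec (R i)) a →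
        ¬ Q a → R a → (∀ i → i ≢ a → Q i → R i) → (∀ i → i ≢ a → R i → Q i) → # R? ≡ suc (# Q?)
#-add {suc n} Q? R? 0F ¬q r f g with Q? 0F | R? 0F
... | yes q | _     = ⊥-elim (¬q q)
... | no _  | no ¬r = ⊥-elim (¬r r)
... | no _  | yes _ = cong suc (#-cong (R? ∘ Fin.suc) (Q? ∘ Fin.suc)
                        (λ i → g (Fin.suc i) (λ ())) (λ i → f (Fin.suc i) (λ ())))
#-add {suc n} Q? R? (Fin.suc a) ¬q r f g
  with Q? 0F | R? 0F | #-add (Q? ∘ Fin.suc) (R? ∘ Fin.suc) a ¬q r
         (λ i i≢a → f (Fin.suc i) (λ { refl → i≢a refl })) (λ i i≢a → g (Fin.suc i) (λ { refl → i≢a refl }))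
... | yes _ | yes _ | e = cong suc e
... | yes q | no ¬r | _ = ⊥-elim (¬r (f 0F (λ ()) q))
... | no ¬q | yes r | _ = ⊥-elim (¬q (g 0F (λ ()) r))
... | no _  | no _  | e = e

#-none : ∀ {n} {Q : Fin n → Set} (Q? : ∀ i → Dec (Q i)) → (∀ i → ¬ Q i) → # Q? ≡ 0
#-none {zero}  Q? f = refl
#-none {suc n} Q? f with Q? 0F
... | yes q = ⊥-elim (f 0F q)
... | no _  = #-none (Q? ∘ Fin.suc) (f ∘ Fin.suc)

#-strict : ∀ {n} {Q R : Fin n → Set} (Q? : ∀ i → Dec (Q i)) (R? : ∀ i → Dec (R i)) a →
           ¬ Q a → R a → (∀ i → Q i → R i) → # Q? < # R?
#-strict Q? R? a ¬q r f = ≤-trans (≤-reflexive (sym (#-add Q? S? a ¬q (r , λ ¬e → ⊥-elim (¬e refl))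
                                      (λ i _ q → f i q , λ _ → q) λ i i≢a s → proj₂ s i≢a)))
                            (#-mono S? R? (λ i → proj₁))
  where
  -- This is `Q` with `a` adjoined, put as a subset of `R` so that it differs from `Q` by exactly
  -- one element.
  S? : ∀ i → Dec (_ × (i ≢ a → _))
  S? i with i ≟ a | Q? i | R? i
  ... | _        | _     | no ¬r = no λ s → ¬r (proj₁ s)
  ... | yes refl | _     | yes r = yes (r , λ ¬e → ⊥-elim (¬e refl))
  ... | no _     | yes q | yes r = yes (r , λ _ → q)
  ... | no i≢a   | no ¬q | yes r = no λ s → ¬q (proj₂ s i≢a)

module _ {n : ℕ} {_≼_ : Fin n → Fin n → Set} (≼-refl : ∀ {a} → a ≼ a)
         (≼-trans : ∀ {a b c} → a ≼ b → b ≼ c → a ≼ c) (≼-total : ∀ a b → a ≼ b ⊎ b ≼ a) where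

  -- The order is a parameter so that the converse of `≤₁` yields greatest elements.
  least : {Q : Fin n → Set} → (∀ i → Dec (Q i)) → ∀ a → Q a → ∃[ m ] Q m × ∀ b → Q b → m ≼ b
  least {Q} Q? a q = let m , qm , _ , f = go (allFin n) a q in m , qm , λ b → f (∈-allFin b)
    where
    go : ∀ bs a → Q a → ∃[ m ] Q m × m ≼ a × ∀ {b} → b ∈ bs → Q b → m ≼ b
    go []       a q = a , q , ≼-refl , λ ()
    go (b ∷ bs) a q with Q? b | ≼-total a b
    ... | no ¬qb | _ with m , qm , m≼a , f ← go bs a q =
      m , qm , m≼a , λ { (here refl) qb → ⊥-elim (¬qb qb) ; (there b∈) → f b∈ }
    go (b ∷ bs) a q | yes qb | inj₁ a≼b with m , qm , m≼a , f ← go bs a q =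
      m , qm , m≼a , λ { (here refl) _ → ≼-trans m≼a a≼b ; (there b∈) → f b∈ }
    go (b ∷ bs) a q | yes qb | inj₂ b≼a with m , qm , m≼b , f ← go bs b qb =
      m , qm , ≼-trans m≼b b≼a , λ { (here refl) _ → m≼b ; (there b∈) → f b∈ }

-- Counting tokens in a model

module Tokens (M : Structure) where
  open Structure M
  open Orders M
  private
    module O₁ = IsTotalOrder isLinearOrder₁

  Below : Universe → Universe → Set
  Below a b = T (pred 0 b) × ¬ (a ≤¹ b)

  below? : ∀ a b → Dec (Below a b)
  below? a b = T? _ ×-dec ¬? (T? _)

  tokens : ℕ
  tokens = # (λ b → T? (pred 0 b))

  tokensBelow⇒≤ : ∀ k {ρ} → Holds M ρ (tokensBelow k) → k ≤ # (below? (ρ x))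
  tokensBelow⇒≤ zero    h = z≤n
  tokensBelow⇒≤ (suc k) {ρ} (b , p , b<a , .b , refl , h) =
    ≤-trans (s≤s (tokensBelow⇒≤ k h))
      (#-strict (below? b) (below? (ρ x)) b (λ (_ , b<b) → b<b O₁.refl) (p , b<a)
        (λ c (q , c<b) → q , λ a≤c → b<a (O₁.trans a≤c (≤-from c<b))))
    where
    ≤-from : ∀ {b c} → ¬ (b ≤¹ c) → c ≤¹ b
    ≤-from {b} {c} b≰c with O₁.total b c
    ... | inj₁ b≤c = ⊥-elim (b≰c b≤c)
    ... | inj₂ c≤b = c≤b

  -- The witness is the greatest token below `x`: every other token below `x` is below it as well,
  -- so the count drops by exactly one.
  ≤⇒tokensBelow : ∀ k {ρ} → k ≤ # (below? (ρ x)) → Holds M ρ (tokensBelow k)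
  ≤⇒tokensBelow zero    le = refl
  ≤⇒tokensBelow (suc k) {ρ} le with any? (below? (ρ x))
  ... | no none with () ← ≤-trans le (≤-reflexive (#-none (below? (ρ x)) (λ i b → none (i , b))))
  ... | yes (b₀ , w₀)
    with b , (p , b<a) , greatest ← least {_≼_ = λ b c → c ≤¹ b} O₁.refl (λ d e → O₁.trans e d)
                                      (λ b c → O₁.total c b) (below? (ρ x)) b₀ w₀ =
    b , p , b<a , b , refl , ≤⇒tokensBelow k (s≤s⁻¹ (≤-trans le (≤-reflexive count)))
    where
    count : # (below? (ρ x)) ≡ suc (# (below? b))
    count = #-add (below? b) (below? (ρ x)) b (λ (_ , b<b) → b<b O₁.refl) (p , b<a)
      (λ c _ (q , c<b) → q , λ a≤c → c<b (O₁.trans (greatest′ a≤c) a≤c))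
      (λ c c≢b w → proj₁ w , λ b≤c → c≢b (O₁.antisym (greatest c w) b≤c))
      where
      greatest′ : ∀ {c} → ρ x ≤¹ c → b ≤¹ ρ x
      greatest′ _ with O₁.total b (ρ x)
      ... | inj₁ le = le
      ... | inj₂ ge = ⊥-elim (b<a ge)

  exactly⇒tokens : ∀ {n ρ} → (∃[ a ] ∀ b → T (pred 0 b) → ¬ (a ≤¹ b)) →
                   Holds M ρ (exactly n) → tokens ≡ n
  exactly⇒tokens {n} {ρ} (a , above) ((b , h) , ¬h) = ≤-antisym upper lower
    where
    lower : n ≤ tokens
    lower = ≤-trans (tokensBelow⇒≤ n h) (#-mono (below? b) (λ c → T? (pred 0 c)) (λ c → proj₁))
    upper : tokens ≤ n
    upper with tokens ≤?ⁿ n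
    ... | yes le = le
    ... | no nle = ⊥-elim (¬h (a , ≤⇒tokensBelow (suc n) (≤-trans (≰⇒> nle)
                     (#-mono (λ c → T? (pred 0 c)) (below? a) (λ c p → p , above c p)))))

-- Reading a run off a model

module Soundness (N : Machine) where
  open Machine N
  open Logic N

  cycle-≢ : ∀ c → cycle c ≢ c
  cycle-≢ 0F ()
  cycle-≢ 1F ()
  cycle-≢ 2F ()

  cycle²-≢ : ∀ c → cycle (cycle c) ≢ c
  cycle²-≢ 0F ()
  cycle²-≢ 1F ()
  cycle²-≢ 2F ()

  module _ {M : Structure} {lab : Structure.Universe M → Label} (G : Good M lab) where
    open Structure M
    open Orders M
    open Good G
    open Tokens M using (tokens)
    private
      module O₁ = IsTotalOrder isLinearOrder₁
      module O₂ = IsTotalOrder isLinearOrder₂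
      module O₃ = IsTotalPreorder isTotalPreorder₃

    infix 4 _<¹_
    _<¹_ : Universe → Universe → Set
    a <¹ b = ¬ (b ≤¹ a)

    <¹⇒≤¹ : ∀ {a b} → a <¹ b → a ≤¹ b
    <¹⇒≤¹ {a} {b} a<b with O₁.total a b
    ... | inj₁ a≤b = a≤b
    ... | inj₂ b≤a = ⊥-elim (a<b b≤a)

    ≤²-from : ∀ {a b} → ¬ (b ≤² a) → a ≤² b
    ≤²-from {a} {b} a<b with O₂.total a b
    ... | inj₁ a≤b = a≤b
    ... | inj₂ b≤a = ⊥-elim (a<b b≤a)

    Event : Universe → Set
    Event a = IsEvent (lab a)

    event? : ∀ a → Dec (Event a)
    event? a = isEvent? (lab a)

    itemAt : Universe → Item
    itemAt a = item (lab a)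

    colourAt : Universe → Fin 3
    colourAt a = colour (lab a)

    Acts : Kind → ℕ → Universe → Set
    Acts k r a = Does k (lab a) × regOf (itemAt a) ≡ r

    acts? : ∀ k r a → Dec (Acts k r a)
    acts? k r a = does? k (lab a) ×-dec regOf (itemAt a) ≟ⁿ r

    Cancelled : ℕ → Universe → Universe → Set
    Cancelled r a b = ∃[ c ] Acts decᵏ r c × c <¹ a × c ≈³ b

    -- The counters just before a: increments not yet cancelled by a decrement.
    Pending : ℕ → Universe → Universe → Set
    Pending r a b = Acts incᵏ r b × b <¹ a × ¬ Cancelled r a b

    pending? : ∀ r a b → Dec (Pending r a b)
    pending? r a b = acts? incᵏ r b ×-dec ¬? (T? _) ×-dec
      ¬? (any? λ c → acts? decᵏ r c ×-dec ¬? (T? _) ×-dec (T? _ ×-dec T? _))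

    counters : Universe → Reg
    counters a r = # (pending? r a)

    decs-event : ∀ {a r} → Acts decᵏ r a → Event a
    decs-event ((m , k) , _) = m , λ z → contra (trans (sym k) (cong kindOf z))
      where
      contra : decᵏ ≢ incᵏ
      contra ()

    Follows : Universe → Universe → Set
    Follows a b = Event b × a <¹ b × (∀ c → Event c → a <¹ c → b ≤¹ c)

    -- Holds at every event reached from the first one: colours then determine
    -- on which side of a an event inverted with the copy of a lies.
    Chained : Universe → Set
    Chained a = ∀ b → Event b → b <¹ a →
      ∃[ p ] Event p × p <¹ a × b ≤¹ p × colourAt a ≡ cycle (colourAt p)

    module _ {a a′ : Universe} (ea : Event a) (follows : Follows a a′) where

      -- Covers all main elements, tokens included, because tokens act on register 0.
      before-next : ∀ {b} → side (lab b) ≡ 0F → b <¹ a′ → b <¹ a ⊎ b ≡ a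
      before-next {b} m b<a′ with itemAt b ≟ 0F | T? (le₁ b a) | T? (le₁ a b)
      ... | yes z | _       | _       = inj₁ (tokens-first b a (m , z) ea)
      ... | no _  | yes b≤a | yes a≤b = inj₂ (O₁.antisym b≤a a≤b)
      ... | no _  | yes _   | no a≰b  = inj₁ a≰b
      ... | no nz | no b≰a  | _       =
        ⊥-elim (b<a′ (proj₂ (proj₂ follows) b (m , nz) b≰a))

      private
        later : a <¹ a′
        later = proj₁ (proj₂ follows)

      stays-before : ∀ {b} → b <¹ a → b <¹ a′
      stays-before b<a a′≤b = later (O₁.trans a′≤b (<¹⇒≤¹ b<a))

      idle : ∀ r → ¬ Acts incᵏ r a → ¬ Acts decᵏ r a → counters a′ r ≡ counters a r
      idle r ¬inc ¬dec = #-cong (pending? r a′) (pending? r a) to from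
        where
        to : ∀ b → Pending r a′ b → Pending r a b
        to b (i , b<a′ , n) with before-next (proj₁ (proj₁ i)) b<a′
        ... | inj₁ b<a  = i , b<a , λ (c , d , c<a , e) → n (c , d , stays-before c<a , e)
        ... | inj₂ refl = ⊥-elim (¬inc i)
        from : ∀ b → Pending r a b → Pending r a′ b
        from b (i , b<a , n) = i , stays-before b<a , λ (c , d , c<a′ , e) → cancelled c d c<a′ e
          where
          cancelled : ∀ c → Acts decᵏ r c → c <¹ a′ → ¬ (c ≈³ b)
          cancelled c d c<a′ e with before-next (proj₁ (proj₁ d)) c<a′
          ... | inj₁ c<a  = n (c , d , c<a , e)
          ... | inj₂ refl = ¬dec d

      -- The only new pending increment is `a` itself; a decrement that cancels it cannot precede
      -- it.
      increments : ∀ {r} → Acts incᵏ r a → counters a′ r ≡ suc (counters a r)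
      increments {r} ia@((ma , ka) , ra) = #-add (pending? r a) (pending? r a′) a
        (λ (_ , a<a , _) → a<a O₁.refl)
        (ia , later , λ (c , d , c<a′ , e) → uncancelled c d c<a′ e)
        (λ b b≢a (i , b<a , n) → i , stays-before b<a , λ (c , d , c<a′ , e) → n (c , d , dec-before c d c<a′ , e))
        (λ b b≢a (i , b<a′ , n) → i , inc-before b≢a i b<a′ , λ (c , d , c<a , e) → n (c , d , stays-before c<a , e))
        where
        dec-before : ∀ c → Acts decᵏ r c → c <¹ a′ → c <¹ a
        dec-before c d c<a′ with before-next (proj₁ (proj₁ d)) c<a′
        ... | inj₁ c<a  = c<a
        ... | inj₂ refl with () ← trans (sym ka) (proj₂ (proj₁ d))
        inc-before : ∀ {b} → b ≢ a → Acts incᵏ r b → b <¹ a′ → b <¹ a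
        inc-before b≢a i b<a′ with before-next (proj₁ (proj₁ i)) b<a′
        ... | inj₁ b<a = b<a
        ... | inj₂ b≡a = ⊥-elim (b≢a b≡a)
        uncancelled : ∀ c → Acts decᵏ r c → c <¹ a′ → ¬ (c ≈³ a)
        uncancelled c d c<a′ e = inc-before-dec c a (proj₁ d , (ma , ka) , trans (proj₂ d) (sym ra)) e
          (<¹⇒≤¹ (dec-before c d c<a′))

      -- The matched increment `b` is the one lost. Uniqueness of an operation within a class is
      -- used twice: no earlier decrement has cancelled `b`, and `a` cancels no other increment.
      decrements : ∀ {r} → Acts decᵏ r a → counters a r ≡ suc (counters a′ r)
      decrements {r} da@(ka , ra) with dec-matched a ka
      ... | b , m@(_ , kb , rab) , a≈b = #-add (pending? r a′) (pending? r a) b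
        (λ (_ , _ , n) → n (a , da , later , a≈b))
        ((kb , trans (sym rab) ra) , inc-before-dec′ , λ (c , d , c<a , e) → uncancelled c d c<a e)
        (λ i i≢b (ii , i<a′ , n) → ii , inc-before ii i<a′ , λ (c , d , c<a , e) → n (c , d , stays-before c<a , e))
        (λ i i≢b (ii , i<a , n) → ii , stays-before i<a , λ (c , d , c<a′ , e) → still i≢b ii n c d c<a′ e)
        where
        inc-before-dec′ : b <¹ a
        inc-before-dec′ a≤b = inc-before-dec a b m a≈b a≤b
        uncancelled : ∀ c → Acts decᵏ r c → c <¹ a → ¬ (c ≈³ b)
        uncancelled c (kc , rc) c<a (c≤b , b≤c) = c<a (O₁.reflexive (sameOp-unique a c
          (proj₁ ka , proj₁ kc , trans (proj₂ ka) (sym (proj₂ kc)) , trans ra (sym rc))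
          (O₃.trans (proj₁ a≈b) b≤c , O₃.trans c≤b (proj₂ a≈b))))
        inc-before : ∀ {i} → Acts incᵏ r i → i <¹ a′ → i <¹ a
        inc-before ii i<a′ with before-next (proj₁ (proj₁ ii)) i<a′
        ... | inj₁ i<a  = i<a
        ... | inj₂ refl with () ← trans (sym (proj₂ ka)) (proj₂ (proj₁ ii))
        still : ∀ {i} → i ≢ b → Acts incᵏ r i → ¬ Cancelled r a i →
                ∀ c → Acts decᵏ r c → c <¹ a′ → ¬ (c ≈³ i)
        still {i} i≢b (ki , ri) n c d c<a′ (c≤i , i≤c) with before-next (proj₁ (proj₁ d)) c<a′
        ... | inj₁ c<a  = n (c , d , c<a , c≤i , i≤c)
        ... | inj₂ refl = i≢b (sameOp-unique i b
          (proj₁ ki , proj₁ kb , trans (proj₂ ki) (sym (proj₂ kb)) , trans ri (trans (sym ra) rab))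
          (O₃.trans i≤c (proj₁ a≈b) , O₃.trans (proj₂ a≈b) c≤i))

      tests : ∀ {r} → Acts testᵏ r a → counters a r ≡ 0
      tests {r} (ka , ra) = #-none (pending? r a) none
        where
        none : ∀ b → ¬ Pending r a b
        none b ((kb , rb) , b<a , n) with inc-matched b kb
        ... | inj₂ unmatched = b<a (unmatched a (ka , kb , trans ra (sym rb)))
        ... | inj₁ (c , (kc , _ , rcb) , c≈b@(c≤b , b≤c)) =
          n (c , (kc , trans rcb rb) , c<a , c≈b)
          where
          mc : Matching testᵏ decᵏ (lab a) (lab c)
          mc = ka , kc , trans ra (trans (sym rb) (sym rcb))
          a≰b : ¬ (a ≤³ b)
          a≰b = inc-before-test a b (ka , kb , trans ra (sym rb)) b<a
          a≢c : a ≢ c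
          a≢c refl with () ← trans (sym (proj₂ ka)) (proj₂ kc)
          c<a : c <¹ a
          -- Were the test before `c`, it would be at most `c` in `≾₃`, hence at most `b`, which
          -- shares the class of `c`.
          c<a a≤c = a≰b (O₃.trans (dec-after-test a c mc (λ c≤a → a≢c (O₁.antisym a≤c c≤a))) c≤b)

      executes : kindOf (itemAt a) ≢ haltᵏ →
                 Exec (kindOf (itemAt a)) (regOf (itemAt a)) (counters a) (counters a′)
      executes ¬halt = go (kindOf (itemAt a)) refl
        where
        m = proj₁ ea
        go : ∀ k → kindOf (itemAt a) ≡ k → Exec k (regOf (itemAt a)) (counters a) (counters a′)
        go incᵏ  e = inc (increments ((m , e) , refl))
          (λ s r≢s → idle s (λ (_ , r≡s) → r≢s r≡s) (λ (_ , r≡s) → r≢s r≡s))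
        go decᵏ  e = dec (decrements ((m , e) , refl))
          (λ s r≢s → idle s (λ (_ , r≡s) → r≢s r≡s) (λ (_ , r≡s) → r≢s r≡s))
        go testᵏ e = test (tests ((m , e) , refl))
          (λ s → idle s (λ ((_ , k) , _) → not-inc (trans (sym e) k))
                        (λ ((_ , k) , _) → not-dec (trans (sym e) k)))
          where
          not-inc : testᵏ ≢ incᵏ
          not-inc ()
          not-dec : testᵏ ≢ decᵏ
          not-dec ()
        go haltᵏ e = ⊥-elim (¬halt e)

    advance : ∀ {a} → Event a → Chained a → kindOf (itemAt a) ≢ haltᵏ →
              ∃[ a′ ] Follows a a′ × T (nextOf (itemAt a) (itemAt a′)) × Chained a′
    advance {a} ea chain ¬halt
      with d , (sd , cd , id) , (d≤a , a≤d) , (d<a , a<d) ← has-copy a (ea , ¬halt)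
      with active ← (sd , (λ z → proj₂ ea (trans (sym id) z)) , λ h → ¬halt (trans (cong kindOf (sym id)) h))
      with b , eb , (cb , _) , (d<b , b<d) ← copy-has-next d active
      = a′ , (ea′ , a<a′ , λ c ec a<c → a′≤ c (ec , a<c)) , proj₁ nx , chained
      where
      cb′ : colourAt b ≡ cycle (colourAt a)
      cb′ = trans cb (cong cycle cd)
      b≰a : ¬ (b ≤¹ a)
      -- If `b` came before `a`, the chain would give an event `p` from `b` on and before `a`, one
      -- colour behind `a`. Lying between `b` and `a` in both orders, `p` is inverted with `d`, but
      -- it has neither the colour of `a` nor the following one.
      b≰a b≤a with chain b eb (λ a≤b → cycle-≢ (colourAt a)
                     (trans (sym cb′) (cong colourAt (O₁.antisym b≤a a≤b))))
      ... | p , ep , p<a , b≤p , cp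
        with copy-inverts d p active ep
               ((λ p≤d → d<b (O₁.trans b≤p p≤d)) ,
                (λ d≤p → a<d (O₂.trans d≤p (≤²-from (events-agree p a ep ea p<a)))))
      ... | inj₁ ((cdp , _) , _) = cycle-≢ (colourAt p) (trans (sym cp) (trans (sym cd) cdp))
      ... | inj₂ (cpd , _) = cycle²-≢ (colourAt p)
              (trans (cong cycle (trans (sym cp) (sym cd))) (sym cpd))
      above? : ∀ c → Dec (Event c × a <¹ c)
      above? c = event? c ×-dec ¬? (T? _)
      first = least {_≼_ = _≤¹_} O₁.refl O₁.trans O₁.total above? b (eb , b≰a)
      a′ = proj₁ first
      ea′ = proj₁ (proj₁ (proj₂ first))
      a<a′ = proj₂ (proj₁ (proj₂ first))
      a′≤ = proj₂ (proj₂ first)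
      -- The least event `a′` after `a` is at most `b` in both orders, hence inverted with `d` too,
      -- and the axiom on copies applies to it in place of `b`.
      a′≤²b : a′ ≤² b
      a′≤²b with T? (le₁ b a′)
      ... | yes b≤a′ = O₂.reflexive (O₁.antisym (a′≤ b (eb , b≰a)) b≤a′)
      ... | no b≰a′  = ≤²-from (events-agree a′ b ea′ eb b≰a′)
      nx : T (nextOf (itemAt a) (itemAt a′)) × colourAt a′ ≡ cycle (colourAt a)
      nx with copy-inverts d a′ active ea′
                ((λ a′≤d → d<a (O₁.trans (<¹⇒≤¹ a<a′) a′≤d)) , (λ d≤a′ → b<d (O₂.trans d≤a′ a′≤²b)))
      ... | inj₂ (c , n) = subst (λ i → T (nextOf i (itemAt a′))) id n , trans c (cong cycle cd)
      ... | inj₁ ((_ , i) , (d≤a′ , a′≤d)) = ⊥-elim (a<a′ (O₁.reflexive (sym (sameOp-unique a a′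
              (proj₁ ea , proj₁ ea′ , cong kindOf (trans (sym id) i) , cong regOf (trans (sym id) i))
              (O₃.trans a≤d d≤a′ , O₃.trans a′≤d d≤a)))))
      chained : Chained a′
      chained c ec c<a′ with before-next ea (ea′ , a<a′ , λ c ec a<c → a′≤ c (ec , a<c)) (proj₁ ec) c<a′
      ... | inj₁ c<a  = a , ea , a<a′ , <¹⇒≤¹ c<a , proj₂ nx
      ... | inj₂ refl = a , ea , a<a′ , O₁.refl , proj₂ nx

    event-item : ∀ {a} → Event a → ∃[ l ] itemAt a ≡ Fin.suc l
    event-item {a} (_ , nz) = go (itemAt a) nz
      where
      go : ∀ i → i ≢ 0F → ∃[ l ] i ≡ Fin.suc l
      go 0F          nz = ⊥-elim (nz refl)
      go (Fin.suc l) _  = l , refl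

    above? : ∀ a b → Dec (Event b × a <¹ b)
    above? a b = event? b ×-dec ¬? (T? _)

    -- The number of later events decreases along the run, and `advance` ensures that the events
    -- cannot run out before a halt.
    accepts-from : ∀ k {a} → # (above? a) < k → Event a → Chained a →
                   ∀ {l} → itemAt a ≡ Fin.suc l → Accepts l (counters a)
    accepts-from (suc k) {a} (s≤s le) ea chain {l} eq with kind l ≟ haltᵏ
    ... | yes halt = stop halt
    ... | no ¬halt
      with a′ , follows@(ea′ , a<a′ , _) , n , chain′ ← advance ea chain (λ h → ¬halt (trans (cong kindOf (sym eq)) h))
      with l′ , eq′ ← event-item ea′ = step
      (subst (λ i → Exec (kindOf i) (regOf i) (counters a) (counters a′)) eq
        (executes ea follows (λ h → ¬halt (trans (cong kindOf (sym eq)) h))))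
      (subst₂ (λ i j → T (nextOf i j)) eq eq′ n)
      (accepts-from k (≤-trans (#-strict (above? a′) (above? a) a′ (λ (_ , a′<a′) → a′<a′ O₁.refl)
          (ea′ , a<a′) (λ b (eb , a′<b) → eb , λ b≤a → a′<b (O₁.trans b≤a (<¹⇒≤¹ a<a′)))) le)
        ea′ chain′ eq′)

    firstEvent : ∃[ a ] Event a × ∀ b → Event b → a ≤¹ b
    firstEvent = least {_≼_ = _≤¹_} O₁.refl O₁.trans O₁.total event? (proj₁ has-event) (proj₂ has-event)

    good-accepts : ∃[ l ] ∃[ σ ] T (start l) × Accepts l σ × σ 0 ≡ tokens × (∀ r → r ≢ 0 → σ r ≡ 0)
    good-accepts with a , ea , a≤ ← firstEvent with first-starts a ea
    ... | inj₂ (b , eb , b<a) = ⊥-elim (b<a (a≤ b eb))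
    ... | inj₁ starts with l , eq ← event-item ea =
      l , counters a , subst (λ i → T (startOf i)) eq starts ,
      accepts-from _ ≤-refl ea (λ b eb b<a → ⊥-elim (b<a (a≤ b eb))) eq ,
      -- Before the least event there are no decrements, and only tokens can be increments, so the
      -- input is the number of tokens.
      #-cong (pending? 0 a) (λ b → T? (pred 0 b))
        (λ b w → token⇒marked b (is-token w))
        (λ b p → let t = marked⇒token b p in
          ((proj₁ t , cong kindOf (proj₂ t)) , cong regOf (proj₂ t)) , tokens-first b a t ea ,
          λ (c , d , c<a , _) → c<a (a≤ c (decs-event d))) ,
      λ r r≢0 → #-none (pending? r a) (λ b w → r≢0 (trans (sym (proj₂ (proj₁ w))) (cong regOf (proj₂ (is-token w)))))
      where
      is-token : ∀ {r b} → Pending r a b → IsToken (lab b)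
      is-token {b = b} (((m , _) , _) , b<a , _) =
        m , decidable-stable (itemAt b ≟ 0F) (λ nz → b<a (a≤ b (m , nz)))

    events-above-tokens : ∃[ a ] ∀ b → T (pred 0 b) → ¬ (a ≤¹ b)
    events-above-tokens = proj₁ firstEvent , λ b p →
      tokens-first b (proj₁ firstEvent) (marked⇒token b p) (proj₁ (proj₂ firstEvent))

  model⇒accepts : ∀ c M → (∀ a b → Holds M (assign M a b) (theory ∧ exactly c)) →
                  ∃[ l ] ∃[ σ ] T (start l) × Accepts l σ × σ 0 ≡ c × (∀ r → r ≢ 0 → σ r ≡ 0)
  model⇒accepts c M h =
    let lab , G = theory⇒Good {M} (λ a b → proj₁ (h a b))
        l , σ , s , a , σ0 , σr = good-accepts G
    in l , σ , s , a , trans σ0 (Tokens.exactly⇒tokens M {ρ = assign M 0F 0F} (events-above-tokens G) (proj₂ (h 0F 0F))) , σr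

-- Models from accepting runs

rank-preorder : ∀ {n} (r : Fin n → ℕ) → IsTotalPreorder _≡_ (Related λ a b → r a ≤ᵇ r b)
rank-preorder r = record
  { isPreorder = record
    { isEquivalence = isEquivalence
    ; reflexive     = λ { {a} refl → ≤⇒≤ᵇ {r a} ≤-refl }
    ; trans         = λ {a} {b} {c} p q → ≤⇒≤ᵇ (≤-trans (≤ᵇ⇒≤ (r a) (r b) p) (≤ᵇ⇒≤ (r b) (r c) q))
    }
  ; total = total
  }
  where
  total : ∀ a b → Related (λ a b → r a ≤ᵇ r b) a b ⊎ Related (λ a b → r a ≤ᵇ r b) b a
  total a b with ≤-total (r a) (r b)
  ... | inj₁ le = inj₁ (≤⇒≤ᵇ le)
  ... | inj₂ ge = inj₂ (≤⇒≤ᵇ ge)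

rank-order : ∀ {n} (r : Fin n → ℕ) → (∀ {a b} → r a ≡ r b → a ≡ b) →
             IsTotalOrder _≡_ (Related λ a b → r a ≤ᵇ r b)
rank-order r inj = record
  { isPartialOrder = record
    { isPreorder = IsTotalPreorder.isPreorder (rank-preorder r)
    ; antisym    = λ {a} {b} p q → inj (≤-antisym (≤ᵇ⇒≤ (r a) (r b) p) (≤ᵇ⇒≤ (r b) (r a) q))
    }
  ; total = IsTotalPreorder.total (rank-preorder r)
  }

bump-yes : ∀ {A : Set} (d : Dec A) {k} → A → bump d k ≡ suc k
bump-yes (yes _) a = refl
bump-yes (no ¬a) a = ⊥-elim (¬a a)

bump-no : ∀ {A : Set} (d : Dec A) {k} → ¬ A → bump d k ≡ k
bump-no (yes a) ¬a = ⊥-elim (¬a a)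
bump-no (no _)  ¬a = refl

bump-mono-≤ : ∀ {A : Set} (d : Dec A) {k l} → k ≤ l → bump d k ≤ bump d l
bump-mono-≤ (yes _) le = s≤s le
bump-mono-≤ (no _)  le = le

bump-mono-< : ∀ {A : Set} (d : Dec A) {k l} → k < l → bump d k < bump d l
bump-mono-< (yes _) lt = s≤s lt
bump-mono-< (no _)  lt = lt

double-≤ : ∀ {m n} → m + m ≤ n + n → m ≤ n
double-≤ {m} {n} le with n <? m
... | yes n<m = ⊥-elim (<⇒≱ (+-mono-< n<m n<m) le)
... | no n≮m  = ≮⇒≥ n≮m

double-injective : ∀ {m n} → m + m ≡ n + n → m ≡ n
double-injective e = ≤-antisym (double-≤ (≤-reflexive e)) (double-≤ (≤-reflexive (sym e)))

odd≢even : ∀ m n → suc (m + m) ≢ n + n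
odd≢even m zero    ()
odd≢even m (suc n) e = odd≢even n m (sym (trans (suc-injective e) (+-suc n n)))

input : ℕ → Reg
input n zero    = n
input n (suc r) = 0

input-0 : ∀ r → input 0 r ≡ 0
input-0 zero    = refl
input-0 (suc r) = refl

-- Traces of accepting runs

module Traces (N : Machine) where
  open Machine N
  open Logic N

  Acts : Kind → ℕ → Item → Set
  Acts k r i = kindOf i ≡ k × regOf i ≡ r

  acts? : ∀ k r i → Dec (Acts k r i)
  acts? k r i = kindOf i ≟ k ×-dec regOf i ≟ⁿ r

  -- Demanded of the tail after every token, so that the condition reaches the event following the
  -- last token.
  Startable : List Item → Set
  Startable []              = ⊤
  Startable (0F ∷ _)        = ⊤
  Startable (Fin.suc l ∷ _) = T (start l)

  data Trace : Reg → List Item → Set where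
    last  : ∀ {σ l} → kind l ≡ haltᵏ → Trace σ (Fin.suc l ∷ [])
    event : ∀ {σ σ′ l l′ L} → Exec (kind l) (reg l) σ σ′ → T (next l l′) →
            Trace σ′ (Fin.suc l′ ∷ L) → Trace σ (Fin.suc l ∷ Fin.suc l′ ∷ L)
    token : ∀ {σ σ′ L} → Exec incᵏ 0 σ σ′ → Startable L → Trace σ′ L → Trace σ (0F ∷ L)

  accepts⇒trace : ∀ {l σ} → Accepts l σ → ∃[ L ] Trace σ (Fin.suc l ∷ L)
  accepts⇒trace (stop h) = [] , last h
  accepts⇒trace (step e n a) with L , t ← accepts⇒trace a = _ , event e n t

  add-tokens : ∀ k {m L} → Startable L → Trace (input (k + m)) L →
               Startable (replicate k 0F ++ L) × Trace (input m) (replicate k 0F ++ L)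
  add-tokens zero    s t = s , t
  add-tokens (suc k) {m} {L} s t
    with s′ , t′ ← add-tokens k s (subst (λ n → Trace (input n) L) (sym (+-suc k m)) t) =
    tt , token (inc refl λ { zero 0≢0 → ⊥-elim (0≢0 refl) ; (suc r) _ → refl }) s′ t′

  count : Kind → ℕ → List Item → ℕ → ℕ
  count k r []      t       = 0
  count k r (i ∷ L) zero    = 0
  count k r (i ∷ L) (suc t) = bump (acts? k r i) (count k r L t)

  module _ {k : Kind} {r : ℕ} where

    count-mono : ∀ L {s t} → s ≤ t → count k r L s ≤ count k r L t
    count-mono []      le       = z≤n
    count-mono (i ∷ L) z≤n      = z≤n
    count-mono (i ∷ L) (s≤s le) = bump-mono-≤ (acts? k r i) (count-mono L le)

    count-strict : ∀ L (i : Fin (length L)) {t} → Acts k r (lookupᴸ L i) → toℕ i < t →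
                   count k r L (toℕ i) < count k r L t
    count-strict (i ∷ L) 0F          a (s≤s lt) =
      ≤-trans (s≤s z≤n) (≤-reflexive (sym (bump-yes (acts? k r i) a)))
    count-strict (i ∷ L) (Fin.suc j) a (s≤s lt) = bump-mono-< (acts? k r i) (count-strict L j a lt)

    -- A count grows by at most one per item, so every smaller value is the index of some item of
    -- that action.
    count-find : ∀ L t {v} → v < count k r L t →
                 ∃[ i ] Acts k r (lookupᴸ L i) × toℕ i < t × count k r L (toℕ i) ≡ v
    count-find (i ∷ L) (suc t) lt with acts? k r i in eq
    count-find (i ∷ L) (suc t) {zero} lt | yes a = 0F , a , s≤s z≤n , refl
    count-find (i ∷ L) (suc t) {suc v} (s≤s lt) | yes a with j , b , j<t , e ← count-find L t lt =
      Fin.suc j , b , s≤s j<t , trans (bump-yes (acts? k r i) a) (cong suc e)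
    count-find (i ∷ L) (suc t) lt | no ¬a with j , b , j<t , e ← count-find L t lt =
      Fin.suc j , b , s≤s j<t , trans (bump-no (acts? k r i) ¬a) e

  -- Conservation over one item. The summand `d` stands for the increments counted among the later
  -- items, so that both sides match the recursion of `count`.
  balance : ∀ {i σ σ′} → Exec (kindOf i) (regOf i) σ σ′ → ∀ r d →
            σ r + bump (acts? incᵏ r i) d ≡ bump (acts? decᵏ r i) (σ′ r + d)
  balance {i} e r d = go (kindOf i) (regOf i) refl refl e
    where
    I? = acts? incᵏ r i
    D? = acts? decᵏ r i
    go : ∀ k s {σ σ′} → kindOf i ≡ k → regOf i ≡ s → Exec k s σ σ′ → σ r + bump I? d ≡ bump D? (σ′ r + d)
    noI : ∀ {k d} → kindOf i ≡ k → k ≢ incᵏ → bump I? d ≡ d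
    noI ke k≢ = bump-no I? λ (ke′ , _) → k≢ (trans (sym ke) ke′)
    noD : ∀ {k d} → kindOf i ≡ k → k ≢ decᵏ → bump D? d ≡ d
    noD ke k≢ = bump-no D? λ (ke′ , _) → k≢ (trans (sym ke) ke′)
    go incᵏ s {σ} {σ′} ke re (inc e f) with s ≟ⁿ r
    ... | yes refl = trans (cong (σ s +_) (bump-yes I? (ke , re)))
                       (trans (+-suc (σ s) d) (trans (cong (_+ d) (sym e)) (sym (noD ke λ ()))))
    ... | no s≢r   = trans (cong₂ _+_ (sym (f r s≢r)) (bump-no I? λ (_ , re′) → s≢r (trans (sym re) re′)))
                       (sym (noD ke λ ()))
    go decᵏ s {σ} {σ′} ke re (dec e f) with s ≟ⁿ r
    ... | yes refl = trans (cong₂ _+_ e (noI ke λ ())) (sym (bump-yes D? (ke , re)))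
    ... | no s≢r   = trans (cong₂ _+_ (sym (f r s≢r)) (noI ke λ ()))
                       (sym (bump-no D? λ (_ , re′) → s≢r (trans (sym re) re′)))
    go testᵏ s ke re (test e f) =
      trans (cong₂ _+_ (sym (f r)) (noI ke λ ())) (sym (noD ke λ ()))

  -- A register is positive at its decrements. Started from zero, this puts the increment of each
  -- index before the decrement of the same index.
  dec-positive : ∀ {σ L r} → Trace σ L → (i : Fin (length L)) → Acts decᵏ r (lookupᴸ L i) →
                 count decᵏ r L (toℕ i) < σ r + count incᵏ r L (toℕ i)
  dec-positive (last h) 0F (k , _) with () ← trans (sym h) k
  dec-positive {σ} {r = r} (event {l = l} e n t) 0F (k , refl) = head e k
    where
    head : ∀ {k σ′} → Exec k (reg l) σ σ′ → k ≡ decᵏ → 0 < σ (reg l) + 0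
    head (dec e _) refl rewrite e = s≤s z≤n
  dec-positive (event {l = l} e n t) (Fin.suc i) a =
    <-≤-trans (bump-mono-< (acts? decᵏ _ (Fin.suc l)) (dec-positive t i a))
              (≤-reflexive (sym (balance {Fin.suc l} e _ _)))
  dec-positive (token e s t) 0F (() , _)
  dec-positive {r = r} (token e s t) (Fin.suc i) a =
    <-≤-trans (bump-mono-< (acts? decᵏ r (Fin.zero {size})) (dec-positive t i a))
              (≤-reflexive (sym (balance {0F} e _ _)))

  test-balanced : ∀ {σ L r} → Trace σ L → (i : Fin (length L)) → Acts testᵏ r (lookupᴸ L i) →
                  count decᵏ r L (toℕ i) ≡ σ r + count incᵏ r L (toℕ i)
  test-balanced (last h) 0F (k , _) with () ← trans (sym h) k
  test-balanced {σ} {r = r} (event {l = l} e n t) 0F (k , refl) = head e k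
    where
    head : ∀ {k σ′} → Exec k (reg l) σ σ′ → k ≡ testᵏ → 0 ≡ σ (reg l) + 0
    head (test e _) refl rewrite e = refl
  test-balanced (event {l = l} e n t) (Fin.suc i) a =
    trans (cong (bump (acts? decᵏ _ (Fin.suc l))) (test-balanced t i a)) (sym (balance {Fin.suc l} e _ _))
  test-balanced (token e s t) 0F (() , _)
  test-balanced {r = r} (token e s t) (Fin.suc i) a =
    trans (cong (bump (acts? decᵏ r (Fin.zero {size}))) (test-balanced t i a)) (sym (balance {0F} e _ _))

  trace-next : ∀ {σ L} → Trace σ L → (i : Fin (length L)) → lookupᴸ L i ≢ 0F → kindOf (lookupᴸ L i) ≢ haltᵏ →
               ∃[ j ] toℕ j ≡ suc (toℕ i) × lookupᴸ L j ≢ 0F × T (nextOf (lookupᴸ L i) (lookupᴸ L j))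
  trace-next (last h)      0F          nz nh = ⊥-elim (nh h)
  trace-next (event e n t) 0F          nz nh = 1F , refl , (λ ()) , n
  trace-next (event e n t) (Fin.suc i) nz nh with j , e′ , r ← trace-next t i nz nh = Fin.suc j , cong suc e′ , r
  trace-next (token e s t) 0F          nz nh = ⊥-elim (nz refl)
  trace-next (token e s t) (Fin.suc i) nz nh with j , e′ , r ← trace-next t i nz nh = Fin.suc j , cong suc e′ , r

  events-only : ∀ {σ l L} → Trace σ (Fin.suc l ∷ L) → ∀ i → lookupᴸ (Fin.suc l ∷ L) i ≢ 0F
  events-only t             0F          ()
  events-only (event e n t) (Fin.suc i) = events-only t i

  trace-first : ∀ {σ L} → Startable L → Trace σ L → (i : Fin (length L)) → lookupᴸ L i ≢ 0F →
                T (startOf (lookupᴸ L i)) ⊎ ∃[ j ] toℕ j < toℕ i × lookupᴸ L j ≢ 0F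
  trace-first s (last h)       0F          nz = inj₁ s
  trace-first s (event e n t)  0F          nz = inj₁ s
  trace-first s (event e n t)  (Fin.suc i) nz = inj₂ (0F , s≤s z≤n , λ ())
  trace-first s (token e s′ t) 0F          nz = ⊥-elim (nz refl)
  trace-first s (token e s′ t) (Fin.suc i) nz with trace-first s′ t i nz
  ... | inj₁ st           = inj₁ st
  ... | inj₂ (j , lt , z) = inj₂ (Fin.suc j , s≤s lt , z)

  token⇒< : ∀ n {L : List Item} → (∀ i → lookupᴸ L i ≢ 0F) → ∀ i → lookupᴸ (replicate n 0F ++ L) i ≡ 0F → toℕ i < n
  token⇒< zero    f i           z = ⊥-elim (f i z)
  token⇒< (suc n) f 0F          z = s≤s z≤n
  token⇒< (suc n) f (Fin.suc i) z = s≤s (token⇒< n f i z)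

  <⇒token : ∀ n {L : List Item} i → toℕ i < n → lookupᴸ (replicate n 0F ++ L) i ≡ 0F
  <⇒token (suc n) 0F          lt       = refl
  <⇒token (suc n) (Fin.suc i) (s≤s lt) = <⇒token n i lt

  tokens-fit : ∀ n (i : Item) {L} → n < length (replicate n (Fin.zero {size}) ++ i ∷ L)
  tokens-fit zero    i = s≤s z≤n
  tokens-fit (suc n) i = s≤s (tokens-fit n i)

-- The model of a trace

module Realization (N : Machine) where
  open Machine N
  open Logic N
  open Traces N

  module FromTrace (n : ℕ) (i₀ : Item) (L₀ : List Item)
    (trace     : Trace (input 0) (i₀ ∷ L₀))
    (startable : Startable (i₀ ∷ L₀))
    (token⇒    : ∀ i → lookupᴸ (i₀ ∷ L₀) i ≡ 0F → toℕ i < n)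
    (⇒token    : ∀ i → toℕ i < n → lookupᴸ (i₀ ∷ L₀) i ≡ 0F)
    (fits      : n < length (i₀ ∷ L₀)) where

    L : List Item
    L = i₀ ∷ L₀

    Time : Set
    Time = Fin (length L)

    at : Time → Item
    at = lookupᴸ L

    Element : Set
    Element = Time ⊎ Time

    time : Element → Time
    time (inj₁ t) = t
    time (inj₂ t) = t

    -- Main elements are inverted with the copies of their own and the previous time only.
    rank₁ rank₂ : Element → ℕ
    rank₁ (inj₁ t) = suc (toℕ t + toℕ t)
    rank₁ (inj₂ t) = toℕ t + toℕ t
    rank₂ (inj₁ t) = toℕ t + toℕ t
    rank₂ (inj₂ t) = 3 + (toℕ t + toℕ t)

    -- Larger than `suc t` for every time `t`, so a test falls strictly between two consecutive
    -- multiples of `bound`, the ranks of increments and decrements.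
    bound : ℕ
    bound = suc (length L)

    -- The k-th increment of a counter shares its rank with the k-th decrement;
    -- a test falls after the increments, and before the decrements, of lower index.
    rankAs : Kind → ℕ → ℕ → ℕ
    rankAs incᵏ  r t = suc (count incᵏ r L t) * bound
    rankAs decᵏ  r t = suc (count decᵏ r L t) * bound
    rankAs testᵏ r t = count incᵏ r L t * bound + suc t
    rankAs haltᵏ r t = t

    rankAt : Time → ℕ
    rankAt t = rankAs (kindOf (at t)) (regOf (at t)) (toℕ t)

    rank₃ : Element → ℕ
    rank₃ e = rankAt (time e)

    colourAt : ℕ → Fin 3
    colourAt zero    = 0F
    colourAt (suc t) = cycle (colourAt t)

    labelOf : Element → Label
    labelOf (inj₁ t) = 0F , colourAt (toℕ t) , at t
    labelOf (inj₂ t) = 1F , colourAt (toℕ t) , at t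

    rank₁-injective : ∀ e f → rank₁ e ≡ rank₁ f → e ≡ f
    rank₁-injective (inj₁ s) (inj₁ t) e = cong inj₁ (toℕ-injective (double-injective (suc-injective e)))
    rank₁-injective (inj₁ s) (inj₂ t) e = ⊥-elim (odd≢even (toℕ s) (toℕ t) e)
    rank₁-injective (inj₂ s) (inj₁ t) e = ⊥-elim (odd≢even (toℕ t) (toℕ s) (sym e))
    rank₁-injective (inj₂ s) (inj₂ t) e = cong inj₂ (toℕ-injective (double-injective e))

    3+-odd : ∀ s t → 3 + (s + s) ≢ t + t
    3+-odd s t e = odd≢even (suc s) t (trans (cong (λ k → suc (suc k)) (+-suc s s)) e)

    rank₂-injective : ∀ e f → rank₂ e ≡ rank₂ f → e ≡ f
    rank₂-injective (inj₁ s) (inj₁ t) e = cong inj₁ (toℕ-injective (double-injective e))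
    rank₂-injective (inj₁ s) (inj₂ t) e = ⊥-elim (3+-odd (toℕ t) (toℕ s) (sym e))
    rank₂-injective (inj₂ s) (inj₁ t) e = ⊥-elim (3+-odd (toℕ s) (toℕ t) e)
    rank₂-injective (inj₂ s) (inj₂ t) e =
      cong inj₂ (toℕ-injective (double-injective (suc-injective (suc-injective (suc-injective e)))))

    view : Fin (length L + length L) → Element
    view = splitAt (length L)

    build : Element → Fin (length L + length L)
    build = join (length L) (length L)

    view-build : ∀ e → view (build e) ≡ e
    view-build = splitAt-join (length L) (length L)

    view-injective : ∀ {u v} → view u ≡ view v → u ≡ v
    view-injective {u} {v} e = trans (sym (join-splitAt (length L) (length L) u))
      (trans (cong build e) (join-splitAt (length L) (length L) v))

    lab : Fin (length L + length L) → Label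
    lab u = labelOf (view u)

    model : Structure
    model = record
      { size-1 = length L₀ + length L
      ; le₁    = λ u v → rank₁ (view u) ≤ᵇ rank₁ (view v)
      ; le₂    = λ u v → rank₂ (view u) ≤ᵇ rank₂ (view v)
      ; le₃    = λ u v → rank₃ (view u) ≤ᵇ rank₃ (view v)
      ; pred   = λ { zero u → isYes (isToken? (lab u)) ; (suc k) u → suc k ≡ᵇ symbol (lab u) }
      ; isLinearOrder₁   = rank-order (λ u → rank₁ (view u)) (λ e → view-injective (rank₁-injective _ _ e))
      ; isLinearOrder₂   = rank-order (λ u → rank₂ (view u)) (λ e → view-injective (rank₂-injective _ _ e))
      ; isTotalPreorder₃ = rank-preorder (λ u → rank₃ (view u))
      }

    counted-dec : ∀ {r} (t : Time) → Acts decᵏ r (at t) → count decᵏ r L (toℕ t) < count incᵏ r L (toℕ t)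
    counted-dec {r} t a = subst (λ z → count decᵏ r L (toℕ t) < z + count incᵏ r L (toℕ t)) (input-0 r) (dec-positive trace t a)

    counted-test : ∀ {r} (t : Time) → Acts testᵏ r (at t) → count decᵏ r L (toℕ t) ≡ count incᵏ r L (toℕ t)
    counted-test {r} t a = subst (λ z → count decᵏ r L (toℕ t) ≡ z + count incᵏ r L (toℕ t)) (input-0 r) (test-balanced trace t a)

    rankAt≡ : ∀ {k r} t → Acts k r (at t) → rankAt t ≡ rankAs k r (toℕ t)
    rankAt≡ t (ke , re) = cong₂ (λ k r → rankAs k r (toℕ t)) ke re

    -- Separates repetitions of one operation, as `sameOp-unique` demands; for halts this is the
    -- purpose of taking the time as rank.
    rankAs-strict : ∀ k {r} (s t : Time) → Acts k r (at s) → toℕ s < toℕ t →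
                    rankAs k r (toℕ s) < rankAs k r (toℕ t)
    rankAs-strict incᵏ  s t a lt = *-monoˡ-< bound (s≤s (count-strict L s a lt))
    rankAs-strict decᵏ  s t a lt = *-monoˡ-< bound (s≤s (count-strict L s a lt))
    rankAs-strict testᵏ s t a lt = +-mono-≤-< (*-monoˡ-≤ bound (count-mono L (<⇒≤ lt))) (s≤s lt)
    rankAs-strict haltᵏ s t a lt = lt

    rankAt-injective : ∀ {k r} s t → Acts k r (at s) → Acts k r (at t) → rankAt s ≡ rankAt t → s ≡ t
    rankAt-injective {k} s t a b e with <-cmp (toℕ s) (toℕ t)
    ... | tri≈ _ s≡t _ = toℕ-injective s≡t
    ... | tri< lt _ _  = ⊥-elim (<-irrefl (trans (sym (rankAt≡ s a)) (trans e (rankAt≡ t b))) (rankAs-strict k s t a lt))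
    ... | tri> _ _ gt  = ⊥-elim (<-irrefl (trans (sym (rankAt≡ t b)) (trans (sym e) (rankAt≡ s a))) (rankAs-strict k t s b gt))

    ≰ᵇ⇒> : ∀ {m k} → ¬ T (m ≤ᵇ k) → k < m
    ≰ᵇ⇒> f = ≰⇒> λ le → f (≤⇒≤ᵇ le)

    >⇒≰ᵇ : ∀ {m k} → k < m → ¬ T (m ≤ᵇ k)
    >⇒≰ᵇ {m} {k} lt le = <⇒≱ lt (≤ᵇ⇒≤ m k le)

    ranks≡ : ∀ {m k} → T (m ≤ᵇ k) × T (k ≤ᵇ m) → m ≡ k
    ranks≡ {m} {k} (p , q) = ≤-antisym (≤ᵇ⇒≤ m k p) (≤ᵇ⇒≤ k m q)

    ≡ranks : ∀ {m k} → m ≡ k → T (m ≤ᵇ k) × T (k ≤ᵇ m)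
    ≡ranks {m} refl = ≤⇒≤ᵇ {m} ≤-refl , ≤⇒≤ᵇ {m} ≤-refl

    double-< : ∀ {s t} → s + s < t + t → s < t
    double-< {s} {t} lt = ≰⇒> λ t≤s → <⇒≱ lt (+-mono-≤ t≤s t≤s)

    double-mono-< : ∀ {s t} → s < t → s + s < t + t
    double-mono-< lt = +-mono-< lt lt

    -- The offset 3 of the copies in the second order serves here: it reaches one time further and
    -- not two, and being odd it avoids the ranks of main elements.
    up-to-next : ∀ {s t} → s + s < 3 + (t + t) → s ≤ suc t
    up-to-next {s} {t} lt = double-≤ (≤-trans (s≤s⁻¹ lt) (≤-reflexive (cong suc (sym (+-suc t t)))))

    next-up-to : ∀ {s t} → s ≤ suc t → s + s < 3 + (t + t)
    next-up-to {s} {t} le = s≤s (≤-trans (+-mono-≤ le le) (≤-reflexive (cong suc (+-suc t t))))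

    open Orders model

    exists : {Q : Element → Set} → ∃[ e ] Q e → ∃[ u ] Q (view u)
    exists {Q} (e , q) = build e , subst Q (sym (view-build e)) q

    _≤ᴱ_ _≤ᴱ²_ _≤ᴱ³_ : Element → Element → Set
    e ≤ᴱ f  = T (rank₁ e ≤ᵇ rank₁ f)
    e ≤ᴱ² f = T (rank₂ e ≤ᵇ rank₂ f)
    e ≤ᴱ³ f = T (rank₃ e ≤ᵇ rank₃ f)

    main-< : ∀ {s t} → ¬ (inj₁ t ≤ᴱ inj₁ s) → toℕ s < toℕ t
    main-< {s} {t} f = double-< (s≤s⁻¹ (≰ᵇ⇒> {rank₁ (inj₁ t)} {rank₁ (inj₁ s)} f))

    <-main : ∀ {s t} → toℕ s < toℕ t → ¬ (inj₁ t ≤ᴱ inj₁ s)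
    <-main lt = >⇒≰ᵇ (s≤s (double-mono-< lt))

    main-≤ : ∀ {s t : Time} → toℕ s ≤ toℕ t → inj₁ s ≤ᴱ inj₁ t
    main-≤ le = ≤⇒≤ᵇ (s≤s (+-mono-≤ le le))

    after-copy : ∀ {s t} → ¬ (inj₁ t ≤ᴱ inj₂ s) → toℕ s ≤ toℕ t
    after-copy {s} {t} f = double-≤ (s≤s⁻¹ (≰ᵇ⇒> {rank₁ (inj₁ t)} {rank₁ (inj₂ s)} f))

    before-copy : ∀ {s t} → ¬ (inj₂ s ≤ᴱ² inj₁ t) → toℕ t ≤ suc (toℕ s)
    before-copy {s} {t} f = up-to-next (≰ᵇ⇒> {rank₂ (inj₂ s)} {rank₂ (inj₁ t)} f)

    copy-inverted : ∀ {s t : Time} → toℕ s ≤ toℕ t → toℕ t ≤ suc (toℕ s) →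
                    ¬ (inj₁ t ≤ᴱ inj₂ s) × ¬ (inj₂ s ≤ᴱ² inj₁ t)
    copy-inverted p q = >⇒≰ᵇ (s≤s (+-mono-≤ p p)) , >⇒≰ᵇ (next-up-to q)

    good : Good model lab
    good = record
      { events-agree    = λ u v → agree (view u) (view v)
      ; copy-inverts    = λ u v → inverts (view u) (view v)
      ; sameOp-unique   = λ u v s e → view-injective (unique (view u) (view v) s e)
      ; inc-before-dec  = λ u v → matched-after (view u) (view v)
      ; inc-before-test = λ u v → inc-test (view u) (view v)
      ; dec-after-test  = λ u v → dec-test (view u) (view v)
      ; tokens-first    = λ u v → tokens-before (view u) (view v)
      ; has-copy        = λ u w → exists (copied (view u) w)
      ; copy-has-next   = λ u w → exists (successor (view u) w)
      ; inc-matched     = λ u w → inc-match (view u) w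
      ; dec-matched     = λ u w → exists (dec-match (view u) w)
      ; has-event       = exists {λ e → IsEvent (labelOf e)} (inj₁ (fromℕ< fits) , refl , λ z →
                            <-irrefl refl (subst (_< n) (toℕ-fromℕ< fits) (token⇒ _ z)))
      ; first-starts    = λ u w → first (view u) w
      ; marked⇒token    = λ u p → toWitness p
      ; token⇒marked    = λ u p → fromWitness p
      }
      where
      agree : ∀ e f → IsEvent (labelOf e) → IsEvent (labelOf f) → ¬ (f ≤ᴱ e) → ¬ (f ≤ᴱ² e)
      agree (inj₁ s) (inj₁ t) _ _ lt = >⇒≰ᵇ (double-mono-< (main-< {s} {t} lt))
      agree (inj₂ _) _ (() , _)
      agree (inj₁ _) (inj₂ _) _ (() , _)

      inverts : ∀ e f → ActiveCopy (labelOf e) → IsEvent (labelOf f) → ¬ (f ≤ᴱ e) × ¬ (e ≤ᴱ² f) →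
                (Same (labelOf e) (labelOf f) × e ≤ᴱ³ f × f ≤ᴱ³ e) ⊎ Next (labelOf e) (labelOf f)
      inverts (inj₁ _) _ (() , _)
      inverts (inj₂ _) (inj₂ _) _ (() , _)
      inverts (inj₂ s) (inj₁ t) (_ , nz , nh) _ (p , q)
        with m≤n⇒m<n∨m≡n (after-copy {s} {t} p)
      ... | inj₂ s≡t with refl ← toℕ-injective s≡t = inj₁ ((refl , refl) , ≡ranks {rankAt t} refl)
      -- The offsets of the ranks leave only `suc s` as a time after `s`.
      ... | inj₁ s<t with trace-next trace s nz nh
      ...   | t′ , e , _ , nx with refl ← toℕ-injective {i = t} {j = t′}
                  (trans (≤-antisym (before-copy {s} {t} q) s<t) (sym e)) = inj₂ (cong colourAt e , nx)

      unique : ∀ e f → SameOp (labelOf e) (labelOf f) → e ≤ᴱ³ f × f ≤ᴱ³ e → e ≡ f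
      unique (inj₁ s) (inj₁ t) (_ , _ , k , r) e =
        cong inj₁ (rankAt-injective s t (k , r) (refl , refl) (ranks≡ {rankAt s} {rankAt t} e))
      unique (inj₂ _) _ (() , _)
      unique (inj₁ _) (inj₂ _) (_ , () , _)

      matched-after : ∀ e f → Matching decᵏ incᵏ (labelOf e) (labelOf f) → e ≤ᴱ³ f × f ≤ᴱ³ e → ¬ (e ≤ᴱ f)
      matched-after (inj₂ _) _ ((() , _) , _)
      matched-after (inj₁ _) (inj₂ _) (_ , (() , _) , _)
      matched-after (inj₁ s) (inj₁ t) ((_ , ks) , (_ , kt) , r) e s≤t =
        -- Equal ranks mean as many increments before `t` as decrements before `s`. But more
        -- increments than that precede `s`, so `t` cannot come at or after `s`.
        <⇒≱ (counted-dec s (ks , r)) (≤-trans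
          (count-mono {incᵏ} {regOf (at t)} L (double-≤ {toℕ s} {toℕ t} (s≤s⁻¹ (≤ᵇ⇒≤ (rank₁ (inj₁ s)) (rank₁ (inj₁ t)) s≤t))))
          (≤-reflexive (sym (suc-injective (*-cancelʳ-≡ (suc (count decᵏ (regOf (at t)) L (toℕ s))) (suc (count incᵏ (regOf (at t)) L (toℕ t))) bound
            (trans (sym (rankAt≡ s (ks , r))) (trans (ranks≡ {rankAt s} {rankAt t} e) (rankAt≡ t (kt , refl)))))))))

      inc-test : ∀ e f → Matching testᵏ incᵏ (labelOf e) (labelOf f) → ¬ (e ≤ᴱ f) → ¬ (e ≤ᴱ³ f)
      inc-test (inj₂ _) _ ((() , _) , _)
      inc-test (inj₁ _) (inj₂ _) (_ , (() , _) , _)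
      inc-test (inj₁ s) (inj₁ t) ((_ , ks) , (_ , kt) , r) t<s = >⇒≰ᵇ
        (subst₂ _<_ (sym (rankAt≡ t (kt , refl))) (sym (rankAt≡ s (ks , r)))
          (≤-<-trans (*-monoˡ-≤ bound (count-strict L t (kt , refl) (main-< {t} {s} t<s))) (m<m+n _ (s≤s z≤n))))

      dec-test : ∀ e f → Matching testᵏ decᵏ (labelOf e) (labelOf f) → ¬ (f ≤ᴱ e) → e ≤ᴱ³ f
      dec-test (inj₂ _) _ ((() , _) , _)
      dec-test (inj₁ _) (inj₂ _) (_ , (() , _) , _)
      dec-test (inj₁ s) (inj₁ t) ((_ , ks) , (_ , kt) , r) s<t = ≤⇒≤ᵇ
        (subst₂ _≤_ (sym (rankAt≡ s (ks , r))) (sym (rankAt≡ t (kt , refl)))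
          -- At the test as many decrements as increments have occurred, so the index of a later
          -- decrement is at least the count used for the test.
          (≤-trans (+-monoʳ-≤ (count incᵏ _ L (toℕ s) * bound) (<⇒≤ (s≤s (toℕ<n s))))
            (≤-trans (≤-reflexive (+-comm _ bound))
              (*-monoˡ-≤ bound (s≤s (≤-trans (≤-reflexive (sym (counted-test s (ks , r))))
                (count-mono L (<⇒≤ (main-< {s} {t} s<t)))))))))

      tokens-before : ∀ e f → IsToken (labelOf e) → IsEvent (labelOf f) → ¬ (f ≤ᴱ e)
      tokens-before (inj₂ _) _ (() , _)
      tokens-before (inj₁ _) (inj₂ _) _ (() , _)
      tokens-before (inj₁ s) (inj₁ t) (_ , z) (_ , nz) =
        <-main {s} {t} (<-≤-trans (token⇒ s z) (≮⇒≥ λ lt → nz (⇒token t lt)))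

      copied : ∀ e → Working (labelOf e) → ∃[ d ] CopyOf (labelOf d) (labelOf e) ×
             (d ≤ᴱ³ e × e ≤ᴱ³ d) × ¬ (e ≤ᴱ d) × ¬ (d ≤ᴱ² e)
      copied (inj₂ _) ((() , _) , _)
      copied (inj₁ t) _ = inj₂ t , (refl , refl , refl) , ≡ranks {rankAt t} refl , copy-inverted {t} {t} ≤-refl (n≤1+n _)

      successor : ∀ d → ActiveCopy (labelOf d) →
                  ∃[ f ] IsEvent (labelOf f) × Next (labelOf d) (labelOf f) × ¬ (f ≤ᴱ d) × ¬ (d ≤ᴱ² f)
      successor (inj₁ _) (() , _)
      successor (inj₂ s) (_ , nz , nh) with t , e , nz′ , nx ← trace-next trace s nz nh =
        inj₁ t , (refl , nz′) , (cong colourAt e , nx) ,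
        copy-inverted {s} {t} (≤-trans (n≤1+n _) (≤-reflexive (sym e))) (≤-reflexive e)

      -- An increment is matched when the whole trace has more decrements than its index. Otherwise
      -- no later test exists, because there the increments, this one among them, would equal the
      -- decrements in number.
      inc-match : ∀ e → Does incᵏ (labelOf e) →
        (∃[ u ] Matching decᵏ incᵏ (lab u) (labelOf e) × view u ≤ᴱ³ e × e ≤ᴱ³ view u) ⊎
        (∀ u → Matching testᵏ incᵏ (lab u) (labelOf e) → view u ≤ᴱ e)
      inc-match (inj₂ _) (() , _)
      inc-match (inj₁ s) (_ , ks)
        with count incᵏ (regOf (at s)) L (toℕ s) <? count decᵏ (regOf (at s)) L (length L)
      ... | yes lt with t , (kt , rt) , _ , e ← count-find L (length L) lt =
        inj₁ (exists {λ f → Matching decᵏ incᵏ (labelOf f) (labelOf (inj₁ s)) × f ≤ᴱ³ inj₁ s × inj₁ s ≤ᴱ³ f}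
          (inj₁ t , ((refl , kt) , (refl , ks) , rt) ,
          ≡ranks {rankAt t} {rankAt s} (trans (rankAt≡ t (kt , rt)) (trans (cong (λ c → suc c * bound) e) (sym (rankAt≡ s (ks , refl)))))))
      ... | no nlt = inj₂ λ u → test-before (view u)
        where
        test-before : ∀ f → Matching testᵏ incᵏ (labelOf f) (labelOf (inj₁ s)) → f ≤ᴱ inj₁ s
        test-before (inj₂ _) ((() , _) , _)
        test-before (inj₁ t) ((_ , kt) , _ , r) = main-≤ {t} {s} (≮⇒≥ λ s<t → nlt
          (<-≤-trans (count-strict L s (ks , refl) s<t)
            (≤-trans (≤-reflexive (sym (counted-test t (kt , r)))) (count-mono L (<⇒≤ (toℕ<n t))))))

      dec-match : ∀ e → Does decᵏ (labelOf e) →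
                  ∃[ f ] Matching decᵏ incᵏ (labelOf e) (labelOf f) × e ≤ᴱ³ f × f ≤ᴱ³ e
      dec-match (inj₂ _) (() , _)
      dec-match (inj₁ s) (_ , ks)
        with t , (kt , rt) , _ , e ← count-find L (toℕ s) (counted-dec s (ks , refl)) =
        inj₁ t , ((refl , ks) , (refl , kt) , sym rt) ,
        ≡ranks {rankAt s} {rankAt t} (trans (rankAt≡ s (ks , refl)) (trans (cong (λ c → suc c * bound) (sym e)) (sym (rankAt≡ t (kt , rt)))))

      first : ∀ e → IsEvent (labelOf e) →
              Starting (labelOf e) ⊎ ∃[ u ] IsEvent (lab u) × ¬ (e ≤ᴱ view u)
      first (inj₂ _) (() , _)
      first (inj₁ t) (_ , nz) with trace-first startable trace t nz
      ... | inj₁ st            = inj₁ st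
      ... | inj₂ (s , s<t , z) = inj₂ (exists {λ f → IsEvent (labelOf f) × ¬ (inj₁ t ≤ᴱ f)} (inj₁ s , (refl , z) , <-main {s} {t} s<t))

    -- The tokens occupy the times below `n`, so the token at time `k` serves as witness and has the
    -- `k` earlier ones below it.
    tokensBelow-intro : ∀ k {ρ t} → view (ρ x) ≡ inj₁ t → k ≤ toℕ t → k ≤ n → Holds model ρ (tokensBelow k)
    tokensBelow-intro zero    e _ _ = refl
    tokensBelow-intro (suc k) {ρ} {t} e k<t k<n =
      build (inj₁ s) , marked , below , build (inj₁ s) , refl ,
      tokensBelow-intro k vb (≤-reflexive (sym s≡)) (<⇒≤ k<n)
      where
      fits′ : k < length L
      fits′ = ≤-trans k<n (<⇒≤ fits)
      s : Time
      s = fromℕ< fits′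
      s≡ : toℕ s ≡ k
      s≡ = toℕ-fromℕ< fits′
      vb : view (build (inj₁ s)) ≡ inj₁ s
      vb = view-build (inj₁ s)
      marked : T (isYes (isToken? (lab (build (inj₁ s)))))
      marked = fromWitness (subst (λ e → IsToken (labelOf e)) (sym vb)
        (refl , ⇒token s (subst (_< n) (sym s≡) k<n)))
      below : ¬ T (rank₁ (view (ρ x)) ≤ᵇ rank₁ (view (build (inj₁ s))))
      below rewrite e | vb = <-main {s} {t} (subst (_< toℕ t) (sym s≡) k<t)

    token-time : ∀ b → T (isYes (isToken? (lab b))) → ∃[ s ] view b ≡ inj₁ s × toℕ s < n
    token-time b p with view b | toWitness {a? = isToken? (lab b)} p
    ... | inj₁ s | _ , z = s , refl , token⇒ s z

    tokensBelow-elim : ∀ k {ρ t} → view (ρ x) ≡ inj₁ t → Holds model ρ (tokensBelow k) → k ≤ toℕ t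
    tokensBelow-elim zero    e h = z≤n
    tokensBelow-elim (suc k) {ρ} {t} e (b , p , b<a , .b , refl , h)
      with s , vb , _ ← token-time b p =
      ≤-<-trans (tokensBelow-elim k vb h) (main-< {s} {t} (subst₂ (λ e f → ¬ (e ≤ᴱ f)) e vb b<a))

    holds-exactly : ∀ ρ → Holds model ρ (exactly n)
    -- The main element at time `n`, the earliest that is not a token.
    holds-exactly ρ = (build (inj₁ (fromℕ< fits)) , tokensBelow-intro n (view-build _)
      (≤-reflexive (sym (toℕ-fromℕ< fits))) ≤-refl) , too-many
      where
      too-many : ¬ Holds model ρ (ex x (tokensBelow (suc n)))
      too-many (a , b , p , _ , .b , refl , h) with s , vb , s<n ← token-time b p =
        <⇒≱ s<n (tokensBelow-elim n vb h)

    holds-theory : ∀ ρ → Holds model ρ theory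
    holds-theory = Good⇒theory {model} {lab} sound complete good
      where
      sound : ∀ u → T (Structure.pred model (symbol (lab u)) u)
      sound u = ≡⇒≡ᵇ (symbol (lab u)) (symbol (lab u)) refl
      complete : ∀ a u → T (Structure.pred model (symbol a) u) → a ≡ lab u
      complete a u p = symbol-injective a (lab u) (≡ᵇ⇒≡ (symbol a) (symbol (lab u)) p)

  accepts⇒model : ∀ n {l} → T (start l) → Accepts l (input n) →
                  ∃[ M ] ∀ ρ → Holds M ρ (theory ∧ exactly n)
  accepts⇒model n {l} s a
    with L , t ← accepts⇒trace a
    with s′ , t′ ← add-tokens n {0} s (subst (λ k → Trace (input k) (Fin.suc l ∷ L)) (sym (+-identityʳ n)) t)
    = go n (replicate n 0F ++ Fin.suc l ∷ L) t′ s′ (token⇒< n (events-only t)) (<⇒token n) (tokens-fit n (Fin.suc l))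
    where
    -- The list is generalised to expose its head, from which the universe is seen to be non-empty.
    go : ∀ n L → Trace (input 0) L → Startable L → (∀ i → lookupᴸ L i ≡ 0F → toℕ i < n) →
         (∀ i → toℕ i < n → lookupᴸ L i ≡ 0F) → n < length L →
         ∃[ M ] ∀ ρ → Holds M ρ (theory ∧ exactly n)
    go n (i₀ ∷ L₀) t s p q f = model , λ ρ → holds-theory ρ , holds-exactly ρ
      where
      open FromTrace n i₀ L₀ t s p q f

-- Diagonalisation

⇓comp₁⁻¹ : ∀ {n f g} {as : Vec ℕ n} {b c} → g [ as ]⇓ b → comp f (g ∷ []) [ as ]⇓ c → f [ b ∷ [] ]⇓ c
⇓comp₁⁻¹ {f = f} {g} {c = c} d (⇓comp {bs = v ∷ []} ds e) =
  subst (λ k → f [ k ∷ [] ]⇓ c) (⇓-deterministic g (ds Fin.zero) d) e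

module Simulation (g : PartialRecursive 1) where

  -- The second part runs forever unless the value of g is 0.
  program : Prog
  program = compile g (0 ∷ []) 1 ++ loop 1 (incr 1 ∷ []) ∷ []

  theory : Formula
  theory = Logic.theory (machine program)

  input-ready : ∀ c → Ready (0 ∷ []) 1 (input c)
  input-ready c = ready (s≤s z≤n ∷ []) λ { (suc r) _ → refl }

  zero⇒model : ∀ c → g [ c ∷ [] ]⇓ 0 → ∃[ M ] ∀ ρ → Holds M ρ (theory ∧ exactly c)
  zero⇒model c d =
    let l , s , a = run-accepts program {input c} (compile-run g (input-ready c) refl d
                      ⨾ exit (upd-same 1) (done (λ _ → refl)))
    in Realization.accepts⇒model (machine program) c s a

  -- A round decrements and increments the same register, so an exit from a positive value would
  -- require a shorter run from a value that is again positive.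
  exits⇒0 : ∀ {σ σ′} → Run (loop 1 (incr 1 ∷ []) ∷ []) σ σ′ → σ 1 ≡ 0
  exits⇒0 (exit e _) = e
  exits⇒0 (iter _ (incr (done e)) d) with () ← trans (sym (trans (sym (e 1)) (upd-same 1))) (exits⇒0 d)

  run-value : ∀ {c σ σ′} → Ready (0 ∷ []) 1 σ → σ 0 ≡ c → Run program σ σ′ → g [ c ∷ [] ]⇓ 0
  run-value {c} R e r =
    let τ , r₁ , r₂ = Run-split (compile g (0 ∷ []) 1) r
        b , d = run-defined g R (cong (_∷ []) e) r₁
    in subst (g [ c ∷ [] ]⇓_)
         (trans (sym (trans (compile-result g R (cong (_∷ []) e) d r₁ 1) (upd-same 1))) (exits⇒0 r₂)) d

  model⇒zero : ∀ c M → (∀ a b → Holds M (assign M a b) (theory ∧ exactly c)) → g [ c ∷ [] ]⇓ 0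
  model⇒zero c M h =
    let l , σ , s , a , σ0 , σr = Soundness.model⇒accepts (machine program) c M h
    in run-value (ready (s≤s z≤n ∷ []) λ { (suc r) _ → σr (suc r) (λ ()) }) σ0 (proj₂ (accepts-run program s a))

code-sentence : ∀ φ → sentenceCode φ ≡ code (proj₁ φ)
code-sentence φ = code-def (proj₁ φ)

closed : Formula → ℕ → Sentence
closed θ c = instantiate θ c , λ { x (x≢x , _) → x≢x refl ; y (_ , y≢y , _) → y≢y refl }

module Diagonal (f : PartialRecursive 1) where
  open Simulation (comp f (diagonalᶠ ∷ [])) renaming (theory to θ)

  φ : Sentence
  φ = closed θ (code θ)

  zero⇒satisfiable : f [ sentenceCode φ ∷ [] ]⇓ 0 → FinitelySatisfiable φ
  zero⇒satisfiable d = let M , h = zero⇒model (code θ) (⇓comp₁ (⇓diagonal θ)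
                                     (subst (λ k → f [ k ∷ [] ]⇓ 0) (code-sentence φ) d)) in
    M , λ ρ a b → h (_[_↦_] M (_[_↦_] M ρ x a) y b)

  satisfiable⇒zero : FinitelySatisfiable φ → f [ sentenceCode φ ∷ [] ]⇓ 0
  satisfiable⇒zero (M , h) = subst (λ k → f [ k ∷ [] ]⇓ 0) (sym (code-sentence φ))
    (⇓comp₁⁻¹ (⇓diagonal θ) (model⇒zero (code θ) M (λ a b → h (λ _ → a) a b)))

1≢0 : 1 ≢ 0
1≢0 ()

theorem4p3 : Undecidable sentenceCode FinitelySatisfiable
-- No case distinction on satisfiability is made: a model would force both values 1 and 0, and the
-- resulting unsatisfiability forces the value 0, which yields a model.
theorem4p3 (f , decides) = unsatisfiable (zero⇒satisfiable (proj₂ (decides φ) unsatisfiable))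
  where
  open Diagonal f
  unsatisfiable : ¬ FinitelySatisfiable φ
  unsatisfiable s = 1≢0 (⇓-deterministic f (proj₁ (decides φ) s) (satisfiable⇒zero s))
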